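{- Let $0<\alpha<1$. The worst-case running time of the algorithm MULE on uncertain graphs with $n$ vertices is within a factor $O(\sqrt{n})$ of the worst-case running time of an optimal algorithm for the Maximal Clique Enumeration problem on uncertain graphs with $n$ vertices; that is, if $T_{\mathrm{MULE}}(n)$ is the worst-case running time of MULE and $T_{A}(n)$ is that of any algorithm $A$ which enumerates all $\alpha$-maximal cliques of every uncertain graph, then $T_{\mathrm{MULE}}(n)=O(\sqrt{n})\cdot T_A(n)$.
   Context: An uncertain graph is a triple $\mathcal{G}=(V,E,p)$, where $V$ is a finite set of vertices, $E$ is a set of undirected edges on $V$ (no self-loops, no multiple edges), and $p:E\to(0,1]$. It represents the distribution over subgraphs of $(V,E)$ obtained by including each edge $e\in E$ independently with probability $p(e)$. For $C\subseteq V$, $\mathrm{clq}(C,\mathcal{G})$ is the probability that $C$ is a clique in a sampled graph; $\mathrm{clq}(\emptyset,\mathcal{G})=1$. $C$ is an $\alpha$-clique if $\mathrm{clq}(C,\mathcal{G})\ge\alpha$. $M\subseteq V$ is an $\alpha$-maximal clique if $M$ is an $\alpha$-clique and there is no $v\in V\setminus M$ such that $M\cup\{v\}$ is an $\alpha$-clique. The Maximal Clique Enumeration problem is to output all $\alpha$-maximal cliques of the input uncertain graph. $\Gamma(u)$ is the set of vertices adjacent to $u$ in $(V,E)$. Vertices are identified with $1,\dots,n$; $\max(C)$ is the largest vertex of $C$, with $\max(\emptyset)=0$. Edges $e$ with $p(e)<\alpha$ are removed from $\mathcal{G}$ before MULE runs. Algorithm MULE$(\mathcal{G},\alpha)$: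 set $\hat I=\{(u,1):u\in V\}$ and call Enum$(\emptyset,1,\hat I,\emptyset)$. Procedure Enum$(C,q,I,X)$, where $C\subseteq V$, $q$ is a real number, and $I,X$ are sets of pairs (vertex, real number): 1. If $I=\emptyset$ and $X=\emptyset$, output $C$ and return. 2. For each $(u,r)\in I$, in increasing order of $u$: set $C'=C\cup\{u\}$, $q'=q\cdot r$, $I'=\mathrm{GenerateI}(C',q',I)$, $X'=\mathrm{GenerateX}(C',q',X)$; call Enum$(C',q',I',X')$; then replace $X$ by $X\cup\{(u,r)\}$. GenerateI$(C',q',I)$: with $m=\max(C')$ and $S=\{u:(u,r)\in I\}\cap\Gamma(m)$, loop over all $(u,r)\in I$ and return the set of pairs $(u,\,r\cdot p(\{u,m\}))$ over those with $u>m$, $u\in S$ and $q'\cdot r\cdot p(\{u,m\})\ge\alpha$. GenerateX$(C',q',X)$: with $m=\max(C')$ and $S=\{v:(v,s)\in X\}\cap\Gamma(m)$, loop over all $(v,s)\in X$ and return the set of pairs $(v,\,s\cdot p(\{v,m\}))$ over those with $v\in S$ and $q'\cdot s\cdot p(\{v,m\})\ge\alpha$. Cost model: arithmetic operations and comparisons on real numbers, looking up the probability $p(e)$ of an edge, testing emptiness of a set and inserting one element into a set each take $O(1)$ time; intersecting two sets of vertices, or copying a set of vertices, takes $O(n)$ time. Any algorithm must write out each $\alpha$-maximal clique explicitly as a list of its vertices, so its running time is at least the sum of the cardinalities of the sets it outputs. -}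

module Defs where

open import Algebra.Bundles using (CommutativeRing)
import Algebra.Definitions.RawMonoid as RawMonoidDefs
open import Data.Bool using (Bool; true; false; _∧_; if_then_else_)
open import Data.Fin as Fin using (Fin; zero; suc)
import Data.Fin.Properties as Fin
open import Data.Fin.Subset using (Subset; inside; outside; _∈_; _∉_; _∪_; _∩_; ⁅_⁆; ⋃; ∣_∣)
  renaming (⊥ to ∅)
open import Data.Fin.Subset.Properties using (_∈?_; x∈p∩q⁺; x∈p∩q⁻; x∈⁅x⁆; q⊆p∪q)
open import Data.List using (List; []; _∷_; _++_; map; filter; foldr; null; length; allFin;
  cartesianProduct)
import Data.List.Membership.DecPropositional as DecMembership
import Data.List.Membership.Propositional as List
open import Data.List.Relation.Unary.Any using (here; there)
open import Data.Maybe using (Maybe; just; nothing)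
open import Data.Nat as ℕ using (ℕ)
import Data.Nat.Induction as ℕ
open import Data.Nat.ListAction using (sum)
import Data.Nat.Properties as ℕ
open import Data.Product using (∃-syntax; _×_; _,_; proj₁; proj₂; uncurry)
open import Data.Product.Properties using (≡-dec)
open import Data.Unit using (⊤; tt)
open import Data.Vec using ([]; _∷_; there; tabulate)
open import Data.Vec.Properties using (lookup∘tabulate; []=⇒lookup; lookup⇒[]=)
open import Function using (_∘_; id)
open import Function.Bundles using (_⇔_)
open import Induction.WellFounded using (Acc; acc)
open import Level as Level using (Level; _⊔_)
open import Relation.Binary using (Rel; IsDecTotalOrder)
open import Relation.Binary.PropositionalEquality using (_≡_; refl; sym; trans; cong; subst)
open import Relation.Nullary using (¬_; Dec; does; yes; contradiction)
open import Relation.Nullary.Decidable using (_→-dec_; dec-true; dec-false)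

-- The axioms of a complete Archimedean ordered field, with decidable order
-- because the algorithm compares reals.
record Reals (c ℓ₁ ℓ₂ : Level) : Set (Level.suc (c ⊔ ℓ₁ ⊔ ℓ₂)) where
  infix 4 _≤_ _<_
  field
    commutativeRing : CommutativeRing c ℓ₁
  open CommutativeRing commutativeRing public
  open RawMonoidDefs +-rawMonoid public using () renaming (_×_ to _·_)
  field
    _≤_             : Rel Carrier ℓ₂
    isDecTotalOrder : IsDecTotalOrder _≈_ _≤_
    0≉1             : ¬ (0# ≈ 1#)
    inverse         : ∀ x → ¬ (x ≈ 0#) → ∃[ y ] x * y ≈ 1#
    +-monoʳ-≤       : ∀ x {y z} → y ≤ z → x + y ≤ x + z
    *-nonneg        : ∀ {x y} → 0# ≤ x → 0# ≤ y → 0# ≤ x * y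
    archimedean     : ∀ x → ∃[ k ] x ≤ k · 1#
  open IsDecTotalOrder isDecTotalOrder public using (_≤?_; ≤-respˡ-≈; ≤-respʳ-≈)
    renaming (refl to ≤-refl; reflexive to ≤-reflexive; trans to ≤-trans;
              antisym to ≤-antisym; total to ≤-total; _≟_ to _≈?_)

  _<_ : Rel Carrier (ℓ₁ ⊔ ℓ₂)
  x < y = x ≤ y × ¬ (x ≈ y)

  Close : Carrier → Carrier → Carrier → Set ℓ₂
  Close ε x y = x ≤ y + ε × y ≤ x + ε

  field
    complete : (f : ℕ → Carrier) →
      (∀ ε → 0# < ε → ∃[ N ] (∀ i j → N ℕ.≤ i → N ℕ.≤ j → Close ε (f i) (f j))) →
      ∃[ L ] (∀ ε → 0# < ε → ∃[ N ] (∀ i → N ℕ.≤ i → Close ε (f i) L))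

-- max ∅ = nothing, where vertices numbered from 1 would give max ∅ = 0.
max : ∀ {n} → Subset n → Maybe (Fin n)
max [] = nothing
max (s ∷ C) with max C
max (s       ∷ C) | just m  = just (suc m)
max (inside  ∷ C) | nothing = just zero
max (outside ∷ C) | nothing = nothing

∈⇒≤max : ∀ {n} (C : Subset n) {u m} → u ∈ C → max C ≡ just m → u Fin.≤ m
∈⇒≤max (s ∷ C) {zero}  u∈C eq = ℕ.z≤n
∈⇒≤max (s ∷ C) {suc u} u∈C eq with max C in eqC
∈⇒≤max (s       ∷ C) {suc u} (there u∈C) refl | just m  = ℕ.s≤s (∈⇒≤max C u∈C eqC)
∈⇒≤max (inside  ∷ C) {suc u} (there u∈C) refl | nothing = contradiction eqC (max-just C u∈C)
  where
  max-just : ∀ {n} (C : Subset n) {u} → u ∈ C → ¬ (max C ≡ nothing)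
  max-just (s ∷ C) {u} u∈C eq with max C in eqC
  max-just (inside  ∷ C) u∈C () | nothing
  max-just (outside ∷ C) (there u∈C) eq | nothing = max-just C u∈C eqC

-- A computation with its value and the number of steps it takes.
record Timed {a} (A : Set a) : Set a where
  constructor _in-time_
  field
    value : A
    steps : ℕ
open Timed public

infixl 1 _>>=_ _>>_

return : ∀ {a} {A : Set a} → A → Timed A
return x = x in-time 0

_>>=_ : ∀ {a b} {A : Set a} {B : Set b} → Timed A → (A → Timed B) → Timed B
m >>= f = value (f (value m)) in-time (steps m ℕ.+ steps (f (value m)))

_>>_ : ∀ {a b} {A : Set a} {B : Set b} → Timed A → Timed B → Timed B
m >> k = m >>= λ _ → k

remember : ∀ {a} {A : Set a} (m : Timed A) → Timed (∃[ x ] value m ≡ x)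
remember m = (value m , refl) in-time steps m

module UncertainGraphs {c ℓ₁ ℓ₂} (ℝ : Reals c ℓ₁ ℓ₂) where
  open Reals ℝ hiding (refl; sym; trans)

  -- V = Fin n and {u , v} ∈ E iff v ∈ Γ u. The values of p off E are irrelevant.
  record UncertainGraph (n : ℕ) : Set (c ⊔ ℓ₁ ⊔ ℓ₂) where
    field
      Γ        : Fin n → Subset n
      Γ-sym    : ∀ {u v} → v ∈ Γ u → u ∈ Γ v
      Γ-irrefl : ∀ {u} → u ∉ Γ u
      p        : Fin n → Fin n → Carrier
      p-sym    : ∀ {u v} → v ∈ Γ u → p u v ≈ p v u
      0<p      : ∀ {u v} → v ∈ Γ u → 0# < p u v
      p≤1      : ∀ {u v} → v ∈ Γ u → p u v ≤ 1#

  -- The edge {u , v} is represented by the pair (u , v) with u < v.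
  Edge : ℕ → Set
  Edge n = Fin n × Fin n

  edges : ∀ {n} → UncertainGraph n → List (Edge n)
  edges {n} 𝒢 = filter (λ (u , v) → v ∈? UncertainGraph.Γ 𝒢 u)
    (filter (λ (u , v) → u Fin.<? v) (cartesianProduct (allFin n) (allFin n)))

  -- All subsets of a list of edges, each with the probability that it is the
  -- set obtained by including every edge e independently with probability w e.
  sample : ∀ {n} → (Edge n → Carrier) → List (Edge n) → List (List (Edge n) × Carrier)
  sample w []       = ([] , 1#) ∷ []
  sample w (e ∷ es) =
    map (λ (S , q) → e ∷ S , w e * q) (sample w es) ++
    map (λ (S , q) → S , (1# - w e) * q) (sample w es)

  infix 4 _∈ᴱ_
  _∈ᴱ_ : ∀ {n} → Edge n → List (Edge n) → Set
  e ∈ᴱ S = e List.∈ S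

  IsClique : ∀ {n} → Subset n → List (Edge n) → Set
  IsClique C S = ∀ u v → u ∈ C → v ∈ C → u Fin.< v → (u , v) ∈ᴱ S

  isClique? : ∀ {n} (C : Subset n) (S : List (Edge n)) → Dec (IsClique C S)
  isClique? C S = Fin.all? λ u → Fin.all? λ v →
    (u ∈? C) →-dec ((v ∈? C) →-dec ((u Fin.<? v) →-dec ((u , v) ∈ᴱ? S)))
    where open DecMembership (≡-dec Fin._≟_ Fin._≟_) renaming (_∈?_ to _∈ᴱ?_)

  clq : ∀ {n} → Subset n → UncertainGraph n → Carrier
  clq C 𝒢 = foldr _+_ 0#
    (map (λ (S , q) → if does (isClique? C S) then q else 0#)
         (sample (uncurry (UncertainGraph.p 𝒢)) (edges 𝒢)))

  IsαClique : ∀ {n} → Carrier → UncertainGraph n → Subset n → Set ℓ₂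
  IsαClique α 𝒢 C = α ≤ clq C 𝒢

  IsαMaximalClique : ∀ {n} → Carrier → UncertainGraph n → Subset n → Set ℓ₂
  IsαMaximalClique α 𝒢 M =
    IsαClique α 𝒢 M × ¬ (∃[ v ] v ∉ M × IsαClique α 𝒢 (M ∪ ⁅ v ⁆))

  -- The only restriction on the running time is that it covers writing out
  -- the vertices of every set in the output.
  record EnumerationAlgorithm (α : Carrier) : Set (c ⊔ ℓ₁ ⊔ ℓ₂) where
    field
      output      : ∀ {n} → UncertainGraph n → List (Subset n)
      enumerates  : ∀ {n} (𝒢 : UncertainGraph n) (M : Subset n) →
                    M List.∈ output 𝒢 ⇔ IsαMaximalClique α 𝒢 M
      time        : ∀ {n} → UncertainGraph n → ℕ
      output≤time : ∀ {n} (𝒢 : UncertainGraph n) → sum (map ∣_∣ (output 𝒢)) ℕ.≤ time 𝒢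

  prune : ∀ {n} → Carrier → UncertainGraph n → UncertainGraph n
  prune {n} α 𝒢 = record
    { Γ        = λ u → Γ u ∩ likely u
    ; Γ-sym    = λ {u} {v} v∈ → let v∈Γu , v∈L = x∈p∩q⁻ (Γ u) (likely u) v∈ in
                 x∈p∩q⁺ (Γ-sym v∈Γu , likely-sym v∈Γu v∈L)
    ; Γ-irrefl = λ {u} → Γ-irrefl ∘ inΓ u
    ; p        = p
    ; p-sym    = λ {u} → p-sym ∘ inΓ u
    ; 0<p      = λ {u} → 0<p ∘ inΓ u
    ; p≤1      = λ {u} → p≤1 ∘ inΓ u
    }
    where
    open UncertainGraph 𝒢
    likely : Fin n → Subset n
    likely u = tabulate λ v → does (α ≤? p u v)
    inΓ : ∀ u {v} → v ∈ Γ u ∩ likely u → v ∈ Γ u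
    inΓ u v∈ = proj₁ (x∈p∩q⁻ (Γ u) (likely u) v∈)
    likely⁻ : ∀ {u v} → v ∈ likely u → α ≤ p u v
    likely⁻ {u} {v} v∈L
      with α ≤? p u v | trans (sym (lookup∘tabulate (λ w → does (α ≤? p u w)) v)) ([]=⇒lookup v∈L)
    ... | yes α≤p | _ = α≤p
    likely⁺ : ∀ {u v} → α ≤ p u v → v ∈ likely u
    likely⁺ {u} {v} α≤p = lookup⇒[]= v (likely u)
      (trans (lookup∘tabulate _ v) (dec-true (α ≤? p u v) α≤p))
    likely-sym : ∀ {u v} → v ∈ Γ u → v ∈ likely u → u ∈ likely v
    likely-sym v∈Γu v∈L = likely⁺ (≤-respʳ-≈ (p-sym v∈Γu) (likely⁻ v∈L))

  -- The algorithm on a fixed graph with n vertices. Every O(1) operation takes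
  -- κ steps and every O(n) operation on sets of vertices takes κ * n steps.
  module Algorithm (κ : ℕ) {n : ℕ} (α : Carrier) (𝒢 : UncertainGraph n) where
    open UncertainGraph 𝒢

    elementary : ℕ → Timed ⊤
    elementary k = tt in-time (κ ℕ.* k)

    setOperation : ℕ → Timed ⊤
    setOperation k = tt in-time (κ ℕ.* n ℕ.* k)

    -- A set of pairs (vertex , real) is a list without repeated vertices. The
    -- lists I are increasing: the initial one is, and generateI keeps the order.
    Pairs : Set c
    Pairs = List (Fin n × Carrier)

    vertices : Pairs → Subset n
    vertices I = ⋃ (map (⁅_⁆ ∘ proj₁) I)

    isEmpty : Pairs → Timed Bool
    isEmpty I = do
      elementary 1
      return (null I)

    -- The 4 elementary operations are the lookup of p u m, two multiplications
    -- and the comparison with α.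
    select : (Fin n → Timed Bool) → Fin n → Carrier → Pairs → Timed Pairs
    select test m q′ []            = return []
    select test m q′ ((u , r) ∷ I) = do
      rest ← select test m q′ I
      passed ← test u
      if passed
        then (do
          elementary 4
          let r′ = r * p u m
          if does (α ≤? q′ * r′)
            then (do
              elementary 1
              return ((u , r′) ∷ rest))
            else return rest)
        else return rest

    -- Finding max C′, extracting the vertices of the pairs, and intersecting
    -- them with Γ m are three set operations. If C′ = ∅ then S = ∅.
    generateI : Subset n → Carrier → Pairs → Timed Pairs
    generateI C′ q′ I = do
      setOperation 3
      loop (max C′)
      where
      loop : Maybe (Fin n) → Timed Pairs
      loop nothing  = return []
      loop (just m) = select test m q′ I
        where
        S = vertices I ∩ Γ m
        test : Fin n → Timed Bool
        test u = do
          elementary 2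
          return (does (m Fin.<? u) ∧ does (u ∈? S))

    generateX : Subset n → Carrier → Pairs → Timed Pairs
    generateX C′ q′ X = do
      setOperation 3
      loop (max C′)
      where
      loop : Maybe (Fin n) → Timed Pairs
      loop nothing  = return []
      loop (just m) = select test m q′ X
        where
        S = vertices X ∩ Γ m
        test : Fin n → Timed Bool
        test v = do
          elementary 1
          return (does (v ∈? S))

    select-≤ : ∀ test m q′ I → length (value (select test m q′ I)) ℕ.≤ length I
    select-≤ test m q′ []            = ℕ.z≤n
    select-≤ test m q′ ((u , r) ∷ I) with value (test u)
    ... | false = ℕ.m≤n⇒m≤1+n (select-≤ test m q′ I)
    ... | true with does (α ≤? q′ * (r * p u m))
    ...   | false = ℕ.m≤n⇒m≤1+n (select-≤ test m q′ I)
    ...   | true  = ℕ.s≤s (select-≤ test m q′ I)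

    select-< : ∀ test m q′ I {u r} → (u , r) List.∈ I → value (test u) ≡ false →
               length (value (select test m q′ I)) ℕ.< length I
    select-< test m q′ ((u , r) ∷ I) (here refl) eq with value (test u)
    ... | false = ℕ.s≤s (select-≤ test m q′ I)
    select-< test m q′ ((u , r) ∷ I) (there x∈I) eq with value (test u)
    ... | false = ℕ.m≤n⇒m≤1+n (select-< test m q′ I x∈I eq)
    ... | true with does (α ≤? q′ * (r * p u m))
    ...   | false = ℕ.m≤n⇒m≤1+n (select-< test m q′ I x∈I eq)
    ...   | true  = ℕ.s≤s (select-< test m q′ I x∈I eq)

    generateI-< : ∀ C q′ I {u r} → (u , r) List.∈ I →
                  length (value (generateI (C ∪ ⁅ u ⁆) q′ I)) ℕ.< length I
    generateI-< C q′ I {u} x∈I with max (C ∪ ⁅ u ⁆) in eq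
    generateI-< C q′ (_ ∷ I) {u} x∈I | nothing = ℕ.s≤s ℕ.z≤n
    generateI-< C q′ I {u} x∈I | just m = select-< _ m q′ I x∈I u≮
      where
      u≤m : u Fin.≤ m
      u≤m = ∈⇒≤max (C ∪ ⁅ u ⁆) (q⊆p∪q C ⁅ u ⁆ (x∈⁅x⁆ u)) eq
      u≮ : does (m Fin.<? u) ∧ does (u ∈? (vertices I ∩ Γ m)) ≡ false
      u≮ = cong (_∧ does (u ∈? (vertices I ∩ Γ m))) (dec-false (m Fin.<? u) (ℕ.≤⇒≯ u≤m))

    -- Recursive calls decrease the length of I.
    enum : Subset n → Carrier → (I X : Pairs) → Acc ℕ._<_ (length I) → Timed (List (Subset n))
    enum C q I X (acc rec) = do
      I-empty ← isEmpty I
      X-empty ← isEmpty X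
      if I-empty ∧ X-empty
        then (do
          elementary ∣ C ∣
          return (C ∷ []))
        else loop I id X
      where
      loop : (J : Pairs) → (∀ {x} → x List.∈ J → x List.∈ I) → Pairs → Timed (List (Subset n))
      loop []            J⊆I X = return []
      loop ((u , r) ∷ J) J⊆I X = do
        setOperation 1
        elementary 1
        let C′ = C ∪ ⁅ u ⁆
        elementary 1
        let q′ = q * r
        I′ , eq ← remember (generateI C′ q′ I)
        X′ ← generateX C′ q′ X
        found ← enum C′ q′ I′ X′
          (rec (subst (λ L → length L ℕ.< length I) eq (generateI-< C q′ I (J⊆I (here refl)))))
        elementary 1
        others ← loop J (J⊆I ∘ there) ((u , r) ∷ X)
        return (found ++ others)

    run : Timed (List (Subset n))
    run = do
      elementary n
      let Î = map (_, 1#) (allFin n)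
      enum ∅ 1# Î [] (ℕ.<-wellFounded (length Î))

  mule : ∀ {n} → ℕ → Carrier → UncertainGraph n → Timed (List (Subset n))
  mule κ α 𝒢 = Algorithm.run κ α (prune α 𝒢)

  muleTime : ∀ {n} → ℕ → Carrier → UncertainGraph n → ℕ
  muleTime κ α 𝒢 = steps (mule κ α 𝒢)

  -- For the supremum T of the running times, T ≤ t says that t bounds all of
  -- them. This also makes sense of an infinite T, and needs no T to be found.
  WorstCase≤ : ∀ {n} → (UncertainGraph n → ℕ) → ℕ → Set (c ⊔ ℓ₁ ⊔ ℓ₂)
  WorstCase≤ time t = ∀ 𝒢 → time 𝒢 ℕ.≤ t

  -- T ≤ K √n t, with both sides squared.
  WorstCase≤√ : ∀ {n} → (UncertainGraph n → ℕ) → ℕ → ℕ → Set (c ⊔ ℓ₁ ⊔ ℓ₂)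
  WorstCase≤√ {n} time K t = ∀ 𝒢 → time 𝒢 ℕ.^ 2 ℕ.≤ K ℕ.^ 2 ℕ.* n ℕ.* t ℕ.^ 2

{-# OPTIONS --safe #-}
module Submission where

-- An increasing list I produces at most 2 ^ ∣ I ∣ calls of enum, because the call
-- for a vertex u keeps only the vertices of I after u; each call costs O(n), so
-- MULE takes O(n 2ⁿ) steps. Conversely let k = ⌈ n / 2 ⌉ and give all edges of the
-- complete graph the same probability p, where p ^ (k choose 2) ≥ α and
-- p ^ (k + 1 choose 2) < α. Every set of k vertices is then an α-maximal clique,
-- and writing all of them out takes k (n choose k) steps, which is at least of
-- the order √ n 2ⁿ.

import Algebra.Properties.Semiring.Exp as Exp
import Algebra.Properties.Semiring.Mult as Mult
open import Defs
open import Data.Bool using (Bool; true; false; _∧_; if_then_else_)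
open import Data.Empty using (⊥)
open import Data.Fin as Fin using (Fin; zero; suc)
import Data.Fin.Properties as Fin
open import Data.Fin.Subset using (Subset; inside; outside; _∈_; _∉_; _∪_; ∁; ⁅_⁆; ∣_∣)
  renaming (⊥ to ∅)
open import Data.Fin.Subset.Properties using (_∈?_; ∣p∣≤n; ∣⊥∣≡0; q⊆p∪q; x∈⁅x⁆; x∈⁅y⁆⇒x≡y;
  x∉p⇒x∈∁p; x∈∁p⇒x∉p; drop-not-there; ∪-identityʳ)
open import Data.List using (List; []; _∷_; _++_; map; foldr; length; filter; filterᵇ; tabulate;
  allFin; cartesianProduct)
import Data.List.Membership.Propositional as List
open import Data.List.Membership.Propositional.Properties using (∈-∃++; ∈-++⁻; ∈-++⁺ˡ; ∈-++⁺ʳ;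
  ∈-map⁻; ∈-filter⁺; ∈-cartesianProduct⁺; ∈-allFin)
import Data.List.Properties as List
open import Data.List.Relation.Binary.Subset.Propositional using (_⊆_)
open import Data.List.Relation.Binary.Subset.Propositional.Properties using (∷⁺ʳ)
open import Data.List.Relation.Unary.All as All using (All; []; _∷_)
import Data.List.Relation.Unary.All.Properties as All
open import Data.List.Relation.Unary.AllPairs using (AllPairs; []; _∷_)
import Data.List.Relation.Unary.AllPairs.Properties as AllPairs
open import Data.List.Relation.Unary.Any using (here; there)
open import Data.List.Relation.Unary.Unique.Propositional using (Unique)
import Data.List.Relation.Unary.Unique.Propositional.Properties as Unique
open import Data.Maybe using (just; nothing)
open import Data.Nat as ℕ using (ℕ; zero; suc; z≤n; s≤s)
import Data.Nat.Combinatorics as ℕ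
import Data.Nat.Induction as ℕ
open import Data.Nat.ListAction using (sum)
open import Data.Nat.ListAction.Properties using (sum-++)
import Data.Nat.Properties as ℕ
open import Data.Nat.Tactic.RingSolver using (solve-∀)
open import Data.Product using (∃-syntax; _×_; _,_; proj₁; proj₂)
open import Data.Sum using (_⊎_; inj₁; inj₂; fromInj₂)
open import Data.Vec using ([]; _∷_; here; there)
import Data.Vec.Properties as Vec
open import Function using (_∘_; id)
open import Function.Bundles using (Equivalence)
open import Induction.WellFounded using (Acc; acc)
open import Relation.Binary using (Poset; IsDecTotalOrder)
open import Relation.Binary.PropositionalEquality using (_≡_; _≢_; refl; sym; trans; cong; cong₂;
  subst; module ≡-Reasoning)
import Relation.Binary.Reasoning.PartialOrder as POReasoning
import Relation.Binary.Reasoning.Setoid as SetoidReasoning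
open import Relation.Nullary using (¬_; Dec; yes; no; does; contradiction)
open import Relation.Nullary.Decidable using (dec-true; dec-false; _×-dec_)
open import Relation.Unary using (Pred; Decidable)

-- Central binomial coefficients

-- Writing out k ≥ n / 2 vertices per clique matches, up to a constant, the O(n) cost of a call of
-- `enum`. The factor √n that remains is the order of the ratio of 2ⁿ to the largest binomial
-- coefficient. Since running times are natural numbers, the comparison is squared throughout and no
-- root occurs in it. With roots of reals, p could be the a-th root of α for a = k choose 2, because
-- every larger exponent b then gives less than α. The field is given only by axioms, so p is
-- instead sought among the powers of a base x slightly below 1: for some j, α lies between x ^ (j *
-- a) and x ^ (suc j * a), and once x is so close to 1 that j ≥ a, the exponent j * b lies beyond
-- this crossing. One Bernoulli inequality makes x close enough to 1, a second one shows that its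
-- powers do fall below α.

[1+k]*[1+n]C[1+k]≡[1+n]*nCk : ∀ n k → suc k ℕ.* (suc n ℕ.C suc k) ≡ suc n ℕ.* (n ℕ.C k)
[1+k]*[1+n]C[1+k]≡[1+n]*nCk zero zero    = refl
[1+k]*[1+n]C[1+k]≡[1+n]*nCk zero (suc k) = ℕ.*-zeroʳ (suc (suc k))
[1+k]*[1+n]C[1+k]≡[1+n]*nCk (suc n) zero =
  trans (ℕ.*-identityˡ _) (trans (ℕ.nC1≡n (suc (suc n))) (sym (ℕ.*-identityʳ _)))
[1+k]*[1+n]C[1+k]≡[1+n]*nCk (suc n) (suc k) = begin
  suc (suc k) ℕ.* (suc (suc n) ℕ.C suc (suc k))
    ≡⟨ cong (suc (suc k) ℕ.*_) (ℕ.nCk+nC[k+1]≡[n+1]C[k+1] (suc n) (suc k)) ⟨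
  suc (suc k) ℕ.* (a ℕ.+ b)                          ≡⟨ expand k a b ⟩
  a ℕ.+ (suc k ℕ.* a ℕ.+ suc (suc k) ℕ.* b)
    ≡⟨ cong (a ℕ.+_) (cong₂ ℕ._+_ ([1+k]*[1+n]C[1+k]≡[1+n]*nCk n k) ([1+k]*[1+n]C[1+k]≡[1+n]*nCk n (suc k))) ⟩
  a ℕ.+ (suc n ℕ.* (n ℕ.C k) ℕ.+ suc n ℕ.* (n ℕ.C suc k))
    ≡⟨ cong (a ℕ.+_) (ℕ.*-distribˡ-+ (suc n) (n ℕ.C k) (n ℕ.C suc k)) ⟨
  a ℕ.+ suc n ℕ.* (n ℕ.C k ℕ.+ n ℕ.C suc k)
    ≡⟨ cong (λ x → a ℕ.+ suc n ℕ.* x) (ℕ.nCk+nC[k+1]≡[n+1]C[k+1] n k) ⟩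
  suc (suc n) ℕ.* (suc n ℕ.C suc k)                    ∎
  where
  open ≡-Reasoning
  a = suc n ℕ.C suc k
  b = suc n ℕ.C suc (suc k)
  expand : ∀ k a b → suc (suc k) ℕ.* (a ℕ.+ b) ≡ a ℕ.+ (suc k ℕ.* a ℕ.+ suc (suc k) ℕ.* b)
  expand = solve-∀

-- The absorption identity is used twice, in rows 2m + 2 and 2m + 1; in between, the symmetry of row
-- 2m + 1 exchanges m and m + 1.
[1+m]*[2+2m]C[1+m]≡2*[1+2m]*[2m]Cm : ∀ m →
  suc m ℕ.* ((suc m ℕ.+ suc m) ℕ.C suc m) ≡ 2 ℕ.* suc (m ℕ.+ m) ℕ.* ((m ℕ.+ m) ℕ.C m)
[1+m]*[2+2m]C[1+m]≡2*[1+2m]*[2m]Cm m = begin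
  suc m ℕ.* ((suc m ℕ.+ suc m) ℕ.C suc m)
    ≡⟨ cong (λ n → suc m ℕ.* (suc n ℕ.C suc m)) (ℕ.+-suc m m) ⟩
  suc m ℕ.* (suc (suc (m ℕ.+ m)) ℕ.C suc m)       ≡⟨ [1+k]*[1+n]C[1+k]≡[1+n]*nCk (suc (m ℕ.+ m)) m ⟩
  suc (suc (m ℕ.+ m)) ℕ.* (suc (m ℕ.+ m) ℕ.C m)   ≡⟨ cong (suc (suc (m ℕ.+ m)) ℕ.*_) flip ⟩
  suc (suc (m ℕ.+ m)) ℕ.* (suc (m ℕ.+ m) ℕ.C suc m) ≡⟨ double m (suc (m ℕ.+ m) ℕ.C suc m) ⟩
  2 ℕ.* (suc m ℕ.* (suc (m ℕ.+ m) ℕ.C suc m))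
    ≡⟨ cong (2 ℕ.*_) ([1+k]*[1+n]C[1+k]≡[1+n]*nCk (m ℕ.+ m) m) ⟩
  2 ℕ.* (suc (m ℕ.+ m) ℕ.* ((m ℕ.+ m) ℕ.C m))       ≡⟨ ℕ.*-assoc 2 (suc (m ℕ.+ m)) _ ⟨
  2 ℕ.* suc (m ℕ.+ m) ℕ.* ((m ℕ.+ m) ℕ.C m)         ∎
  where
  open ≡-Reasoning
  flip : suc (m ℕ.+ m) ℕ.C m ≡ suc (m ℕ.+ m) ℕ.C suc m
  flip = trans (ℕ.nCk≡nC[n∸k] (ℕ.m≤n⇒m≤1+n (ℕ.m≤m+n m m)))
               (cong (suc (m ℕ.+ m) ℕ.C_) (ℕ.m+n∸n≡m (suc m) m))
  double : ∀ m x → suc (suc (m ℕ.+ m)) ℕ.* x ≡ 2 ℕ.* (suc m ℕ.* x)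
  double = solve-∀

-- The quotient of m * C(2m, m)² by 16 ^ m is 1/4 at m = 1 and never decreases, because (2m + 1)²
-- exceeds 4m(m + 1) by 1. The summand `16 * c ^ 2` in the induction step is this excess.
16^m≤4m*[2m]Cm² : ∀ m → 1 ℕ.≤ m → 16 ℕ.^ m ℕ.≤ 4 ℕ.* m ℕ.* ((m ℕ.+ m) ℕ.C m) ℕ.^ 2
16^m≤4m*[2m]Cm² (suc zero)    _ = ℕ.≤-refl
16^m≤4m*[2m]Cm² (suc m@(suc _)) _ = ℕ.*-cancelˡ-≤ (suc m) (begin
  suc m ℕ.* (16 ℕ.* 16 ℕ.^ m)
    ≤⟨ ℕ.*-monoʳ-≤ (suc m) (ℕ.*-monoʳ-≤ 16 (16^m≤4m*[2m]Cm² m (s≤s z≤n))) ⟩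
  suc m ℕ.* (16 ℕ.* (4 ℕ.* m ℕ.* c ℕ.^ 2))          ≤⟨ ℕ.m≤m+n _ (16 ℕ.* c ℕ.^ 2) ⟩
  suc m ℕ.* (16 ℕ.* (4 ℕ.* m ℕ.* c ℕ.^ 2)) ℕ.+ 16 ℕ.* c ℕ.^ 2 ≡⟨ square m c ⟩
  4 ℕ.* (2 ℕ.* suc (m ℕ.+ m) ℕ.* c) ℕ.^ 2
    ≡⟨ cong (λ x → 4 ℕ.* x ℕ.^ 2) ([1+m]*[2+2m]C[1+m]≡2*[1+2m]*[2m]Cm m) ⟨
  4 ℕ.* (suc m ℕ.* c′) ℕ.^ 2                        ≡⟨ regroup m c′ ⟩
  suc m ℕ.* (4 ℕ.* suc m ℕ.* c′ ℕ.^ 2)              ∎)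
  where
  open ℕ.≤-Reasoning
  c  = (m ℕ.+ m) ℕ.C m
  c′ = (suc m ℕ.+ suc m) ℕ.C suc m
  square : ∀ m c → suc m ℕ.* (16 ℕ.* (4 ℕ.* m ℕ.* (c ℕ.* (c ℕ.* 1)))) ℕ.+ 16 ℕ.* (c ℕ.* (c ℕ.* 1)) ≡
           4 ℕ.* (2 ℕ.* suc (m ℕ.+ m) ℕ.* c ℕ.* (2 ℕ.* suc (m ℕ.+ m) ℕ.* c ℕ.* 1))
  square = solve-∀
  regroup : ∀ m c → 4 ℕ.* (suc m ℕ.* c ℕ.* (suc m ℕ.* c ℕ.* 1)) ≡ suc m ℕ.* (4 ℕ.* suc m ℕ.* (c ℕ.* (c ℕ.* 1)))
  regroup = solve-∀

halves : ∀ n → ∃[ m ] (n ≡ m ℕ.+ m ⊎ n ≡ suc (m ℕ.+ m))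
halves zero    = 0 , inj₁ refl
halves (suc n) with halves n
... | m , inj₁ eq = m , inj₂ (cong suc eq)
... | m , inj₂ eq = suc m , inj₁ (cong suc (trans eq (sym (ℕ.+-suc m m))))

4^[m+m]≡16^m : ∀ m → 4 ℕ.^ (m ℕ.+ m) ≡ 16 ℕ.^ m
4^[m+m]≡16^m m = trans (cong (λ n → 4 ℕ.^ (m ℕ.+ n)) (sym (ℕ.+-identityʳ m))) (sym (ℕ.^-*-assoc 4 2 m))

-- The odd case n = 2m + 1 dictates the 8: passing from row 2m to row n gains a factor 4 on the left
-- but only C(2m, m) ≤ C(n, m + 1) on the right, and 4 * 4m ≤ 8n. Rounding k up keeps n ≤ 2k.
4^n≤8n*nCk² : ∀ n → 1 ℕ.≤ n → ∃[ k ] n ℕ.≤ 2 ℕ.* k × 4 ℕ.^ n ℕ.≤ 8 ℕ.* n ℕ.* (n ℕ.C k) ℕ.^ 2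
4^n≤8n*nCk² (suc n) 1≤n with halves (suc n)
... | suc m , inj₁ refl = suc m , ℕ.≤-reflexive (sym (cong (suc m ℕ.+_) (ℕ.+-identityʳ _))) , (begin
  4 ℕ.^ (suc m ℕ.+ suc m)                                       ≡⟨ 4^[m+m]≡16^m (suc m) ⟩
  16 ℕ.^ suc m                                                  ≤⟨ 16^m≤4m*[2m]Cm² (suc m) (s≤s z≤n) ⟩
  4 ℕ.* suc m ℕ.* ((suc m ℕ.+ suc m) ℕ.C suc m) ℕ.^ 2
    ≤⟨ ℕ.*-monoˡ-≤ _ (ℕ.*-mono-≤ (ℕ.m≤m+n 4 4) (ℕ.m≤m+n (suc m) (suc m))) ⟩
  8 ℕ.* (suc m ℕ.+ suc m) ℕ.* ((suc m ℕ.+ suc m) ℕ.C suc m) ℕ.^ 2   ∎)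
  where
  open ℕ.≤-Reasoning
... | zero , inj₁ ()
... | zero , inj₂ refl = 1 , s≤s z≤n , ℕ.m≤m+n 4 4
... | m@(suc _) , inj₂ refl = suc m , ℕ.≤-trans (ℕ.n≤1+n _) (ℕ.≤-reflexive (eq m)) , (begin
  4 ℕ.* 4 ℕ.^ (m ℕ.+ m)                                        ≡⟨ cong (4 ℕ.*_) (4^[m+m]≡16^m m) ⟩
  4 ℕ.* 16 ℕ.^ m
    ≤⟨ ℕ.*-monoʳ-≤ 4 (16^m≤4m*[2m]Cm² m (s≤s z≤n)) ⟩
  4 ℕ.* (4 ℕ.* m ℕ.* c ℕ.^ 2)
    ≤⟨ ℕ.*-monoʳ-≤ 4 (ℕ.*-monoʳ-≤ (4 ℕ.* m) (ℕ.^-monoˡ-≤ 2 c≤d)) ⟩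
  4 ℕ.* (4 ℕ.* m ℕ.* d ℕ.^ 2)                                   ≤⟨ ℕ.m≤m+n _ (8 ℕ.* d ℕ.^ 2) ⟩
  4 ℕ.* (4 ℕ.* m ℕ.* d ℕ.^ 2) ℕ.+ 8 ℕ.* d ℕ.^ 2                 ≡⟨ regroup m (d ℕ.^ 2) ⟩
  8 ℕ.* suc (m ℕ.+ m) ℕ.* d ℕ.^ 2                               ∎)
  where
  open ℕ.≤-Reasoning
  c = (m ℕ.+ m) ℕ.C m
  d = suc (m ℕ.+ m) ℕ.C suc m
  c≤d : c ℕ.≤ d
  c≤d = ℕ.≤-trans (ℕ.m≤m+n c ((m ℕ.+ m) ℕ.C suc m)) (ℕ.≤-reflexive (ℕ.nCk+nC[k+1]≡[n+1]C[k+1] (m ℕ.+ m) m))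
  eq : ∀ m → suc (suc (m ℕ.+ m)) ≡ 2 ℕ.* suc m
  eq = solve-∀
  regroup : ∀ m x → 4 ℕ.* (4 ℕ.* m ℕ.* x) ℕ.+ 8 ℕ.* x ≡ 8 ℕ.* suc (m ℕ.+ m) ℕ.* x
  regroup = solve-∀

-- Sets of k vertices

ofSize : ∀ n → ℕ → List (Subset n)
ofSize n       zero    = ∅ ∷ []
ofSize zero    (suc k) = []
ofSize (suc n) (suc k) = map (inside ∷_) (ofSize n k) ++ map (outside ∷_) (ofSize n (suc k))

length-ofSize : ∀ n k → length (ofSize n k) ≡ n ℕ.C k
length-ofSize n       zero    = refl
length-ofSize zero    (suc k) = refl
length-ofSize (suc n) (suc k) = begin
  length (map (inside ∷_) (ofSize n k) ++ map (outside ∷_) (ofSize n (suc k)))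
    ≡⟨ List.length-++ (map (inside ∷_) (ofSize n k)) ⟩
  length (map (inside ∷_) (ofSize n k)) ℕ.+ length (map (outside ∷_) (ofSize n (suc k)))
    ≡⟨ cong₂ ℕ._+_ (List.length-map _ (ofSize n k)) (List.length-map _ (ofSize n (suc k))) ⟩
  length (ofSize n k) ℕ.+ length (ofSize n (suc k))
    ≡⟨ cong₂ ℕ._+_ (length-ofSize n k) (length-ofSize n (suc k)) ⟩
  n ℕ.C k ℕ.+ n ℕ.C suc k
    ≡⟨ ℕ.nCk+nC[k+1]≡[n+1]C[k+1] n k ⟩
  suc n ℕ.C suc k ∎
  where open ≡-Reasoning

ofSize-∣∣ : ∀ n k → All (λ C → ∣ C ∣ ≡ k) (ofSize n k)
ofSize-∣∣ n       zero    = ∣⊥∣≡0 n ∷ []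
ofSize-∣∣ zero    (suc k) = []
ofSize-∣∣ (suc n) (suc k) =
  All.++⁺ (All.map⁺ (All.map (cong suc) (ofSize-∣∣ n k))) (All.map⁺ (ofSize-∣∣ n (suc k)))

ofSize-unique : ∀ n k → Unique (ofSize n k)
ofSize-unique n       zero    = [] ∷ []
ofSize-unique zero    (suc k) = []
ofSize-unique (suc n) (suc k) =
  Unique.++⁺ (Unique.map⁺ Vec.∷-injectiveʳ (ofSize-unique n k))
             (Unique.map⁺ Vec.∷-injectiveʳ (ofSize-unique n (suc k))) disjoint
  where
  disjoint : ∀ {C} → C List.∈ map (inside ∷_) (ofSize n k) × C List.∈ map (outside ∷_) (ofSize n (suc k)) → _
  disjoint (C∈ , C∈′) with ∈-map⁻ _ C∈ | ∈-map⁻ _ C∈′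
  ... | _ , _ , refl | _ , _ , ()

∣p∪⁅x⁆∣≡1+∣p∣ : ∀ {n} (p : Subset n) {x} → x ∉ p → ∣ p ∪ ⁅ x ⁆ ∣ ≡ suc ∣ p ∣
∣p∪⁅x⁆∣≡1+∣p∣ (inside  ∷ p) {zero}  x∉p = contradiction here x∉p
∣p∪⁅x⁆∣≡1+∣p∣ (outside ∷ p) {zero}  x∉p = cong (suc ∘ ∣_∣) (∪-identityʳ p)
∣p∪⁅x⁆∣≡1+∣p∣ (inside  ∷ p) {suc x} x∉p = cong suc (∣p∪⁅x⁆∣≡1+∣p∣ p (drop-not-there x∉p))
∣p∪⁅x⁆∣≡1+∣p∣ (outside ∷ p) {suc x} x∉p = ∣p∪⁅x⁆∣≡1+∣p∣ p (drop-not-there x∉p)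

module _ {a} {A : Set a} where

  ∈-++-∷⁻ : ∀ (xs : List A) {x y ys} → y List.∈ xs ++ x ∷ ys → x ≢ y → y List.∈ xs ++ ys
  ∈-++-∷⁻ xs y∈ x≢y with ∈-++⁻ xs y∈
  ... | inj₁ y∈xs         = ∈-++⁺ˡ y∈xs
  ... | inj₂ (here eq)    = contradiction (sym eq) x≢y
  ... | inj₂ (there y∈ys) = ∈-++⁺ʳ xs y∈ys

  -- Every entry of `xs` is charged to an occurrence of its own in `ys`, which is then deleted;
  -- uniqueness keeps the later entries in what is left. So an output may contain repetitions and
  -- further sets.
  length-*-≤-sum : ∀ (f : A → ℕ) {k xs} ys → Unique xs → All (λ x → f x ≡ k) xs → All (List._∈ ys) xs →
                   length xs ℕ.* k ℕ.≤ sum (map f ys)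
  length-*-≤-sum f ys []           []        []           = z≤n
  length-*-≤-sum f {k} {x ∷ xs} ys (x≢ ∷ unique) (eq ∷ eqs) (x∈ys ∷ xs⊆ys) with ∈-∃++ x∈ys
  ... | as , bs , refl = begin
    k ℕ.+ length xs ℕ.* k
      ≤⟨ ℕ.+-mono-≤ (ℕ.≤-reflexive (sym eq)) (length-*-≤-sum f (as ++ bs) unique eqs
           (All.zipWith (λ (y∈ , x≢y) → ∈-++-∷⁻ as y∈ x≢y) (xs⊆ys , x≢))) ⟩
    f x ℕ.+ sum (map f (as ++ bs))                       ≡⟨ cong (f x ℕ.+_) (sum-map-++ as bs) ⟩
    f x ℕ.+ (sum (map f as) ℕ.+ sum (map f bs))
      ≡⟨ swap (f x) (sum (map f as)) (sum (map f bs)) ⟩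
    sum (map f as) ℕ.+ (f x ℕ.+ sum (map f bs))          ≡⟨ sum-map-++ as (x ∷ bs) ⟨
    sum (map f (as ++ x ∷ bs))                           ∎
    where
    open ℕ.≤-Reasoning
    sum-map-++ : ∀ as bs → sum (map f (as ++ bs)) ≡ sum (map f as) ℕ.+ sum (map f bs)
    sum-map-++ as bs = trans (cong sum (List.map-++ f as bs)) (sum-++ (map f as) (map f bs))
    swap : ∀ x y z → x ℕ.+ (y ℕ.+ z) ≡ y ℕ.+ (x ℕ.+ z)
    swap = solve-∀

-- Counting the edges inside a set

module _ {a} {A : Set a} where

  count : (A → Bool) → List A → ℕ
  count b = length ∘ filterᵇ b

  count-false : ∀ {b} → (∀ x → b x ≡ false) → ∀ xs → count b xs ≡ 0
  count-false b≡false []       = refl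
  count-false {b} b≡false (x ∷ xs) with b x | b≡false x
  ... | false | _ = count-false b≡false xs

  count-++ : ∀ b xs ys → count b (xs ++ ys) ≡ count b xs ℕ.+ count b ys
  count-++ b []       ys = refl
  count-++ b (x ∷ xs) ys with b x
  ... | true  = cong suc (count-++ b xs ys)
  ... | false = count-++ b xs ys

  length-filter : ∀ {p} {P : Pred A p} (P? : Decidable P) xs → length (filter P? xs) ≡ count (does ∘ P?) xs
  length-filter P? []       = refl
  length-filter P? (x ∷ xs) with does (P? x)
  ... | true  = cong suc (length-filter P? xs)
  ... | false = length-filter P? xs

  filter-filter-⇒ : ∀ {p q} {P : Pred A p} {Q : Pred A q} (P? : Decidable P) (Q? : Decidable Q) →
                    (∀ {x} → P x → Q x) → ∀ xs → filter P? (filter Q? xs) ≡ filter P? xs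
  filter-filter-⇒ P? Q? P⇒Q [] = refl
  filter-filter-⇒ P? Q? P⇒Q (x ∷ xs) with Q? x
  ... | yes Qx with does (P? x)
  ...   | true  = cong (x ∷_) (filter-filter-⇒ P? Q? P⇒Q xs)
  ...   | false = filter-filter-⇒ P? Q? P⇒Q xs
  filter-filter-⇒ P? Q? P⇒Q (x ∷ xs) | no ¬Qx with P? x
  ...   | yes Px = contradiction (P⇒Q Px) ¬Qx
  ...   | no _   = filter-filter-⇒ P? Q? P⇒Q xs

count-map : ∀ {a b} {A : Set a} {B : Set b} (c : B → Bool) (f : A → B) xs → count c (map f xs) ≡ count (c ∘ f) xs
count-map c f []       = refl
count-map c f (x ∷ xs) with c (f x)
... | true  = cong suc (count-map c f xs)
... | false = count-map c f xs

-- Pairs (u , v) with v = zero never satisfy u < v. Deleting that column leaves a product of the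
-- same kind over smaller index sets, on which `count-inside` can recurse.
count-cartesianProduct-suc : ∀ {m n} (b : Fin (suc m) × Fin (suc n) → Bool) → (∀ u → b (suc u , zero) ≡ false) →
  ∀ us vs → count b (cartesianProduct (map suc us) (zero ∷ map suc vs)) ≡
            count (λ (u , v) → b (suc u , suc v)) (cartesianProduct us vs)
count-cartesianProduct-suc b b≡false []       vs = refl
count-cartesianProduct-suc b b≡false (u ∷ us) vs rewrite b≡false u = begin
  count b (map (suc u ,_) (map suc vs) ++ rest)
    ≡⟨ count-++ b (map (suc u ,_) (map suc vs)) rest ⟩
  count b (map (suc u ,_) (map suc vs)) ℕ.+ count b rest
    ≡⟨ cong₂ ℕ._+_ row (count-cartesianProduct-suc b b≡false us vs) ⟩
  count b′ (map (u ,_) vs) ℕ.+ count b′ (cartesianProduct us vs)    ≡⟨ count-++ b′ (map (u ,_) vs) _ ⟨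
  count b′ (map (u ,_) vs ++ cartesianProduct us vs)                ∎
  where
  open ≡-Reasoning
  rest = cartesianProduct (map suc us) (zero ∷ map suc vs)
  b′ : _ → Bool
  b′ (u , v) = b (suc u , suc v)
  row : count b (map (suc u ,_) (map suc vs)) ≡ count b′ (map (u ,_) vs)
  row = trans (count-map b (suc u ,_) (map suc vs))
       (trans (count-map (b ∘ (suc u ,_)) suc vs) (sym (count-map b′ (u ,_) vs)))

tabulate-suc : ∀ n → tabulate Fin.suc ≡ map Fin.suc (allFin n)
tabulate-suc n = sym (List.map-tabulate id Fin.suc)

count-∈ : ∀ {n} (C : Subset n) → count (λ v → does (v ∈? C)) (allFin n) ≡ ∣ C ∣
count-∈ []      = refl
count-∈ {suc n} (s ∷ C) = trans
  (cong (λ vs → count (λ v → does (v ∈? (s ∷ C))) (zero ∷ vs)) (tabulate-suc n)) (first s)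
  where
  rest : ∀ s → count (λ v → does (v ∈? (s ∷ C))) (map suc (allFin n)) ≡ ∣ C ∣
  rest s = trans (count-map (λ v → does (v ∈? (s ∷ C))) suc (allFin n)) (count-∈ C)
  first : ∀ s → count (λ v → does (v ∈? (s ∷ C))) (zero ∷ map suc (allFin n)) ≡ ∣ s ∷ C ∣
  first inside  = cong suc (rest inside)
  first outside = rest outside

-- The recursion adds the edges from one new vertex to the k old ones. This is the induction of
-- `count-inside`, and it shows the strict growth for k ≥ 1 that `separating-power` is applied to.
binom₂ : ℕ → ℕ
binom₂ zero    = 0
binom₂ (suc k) = k ℕ.+ binom₂ k

Inside : ∀ {n} → Subset n → Fin n × Fin n → Set
Inside C (u , v) = u Fin.< v × u ∈ C × v ∈ C

inside? : ∀ {n} (C : Subset n) → Decidable (Inside C)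
inside? C (u , v) = (u Fin.<? v) ×-dec ((u ∈? C) ×-dec (v ∈? C))

count-inside : ∀ {n} (C : Subset n) →
  count (does ∘ inside? C) (cartesianProduct (allFin n) (allFin n)) ≡ binom₂ ∣ C ∣
count-inside {zero} [] = refl
count-inside {suc n} (s ∷ C) = begin
  count b (cartesianProduct (allFin (suc n)) (allFin (suc n)))
    ≡⟨ cong (λ vs → count b (cartesianProduct (zero ∷ vs) (zero ∷ vs))) (tabulate-suc n) ⟩
  -- The diagonal pair (zero , zero) has vanished by computation, since zero < zero fails.
  count b (map (zero ,_) (map suc (allFin n)) ++ rest)
    ≡⟨ count-++ b (map (zero ,_) (map suc (allFin n))) rest ⟩
  count b (map (zero ,_) (map suc (allFin n))) ℕ.+ count b rest
    ≡⟨ cong₂ ℕ._+_ row (trans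
         (count-cartesianProduct-suc b (λ _ → refl) (allFin n) (allFin n))
         (count-inside C)) ⟩
  count (λ v → does (zero ∈? (s ∷ C)) ∧ does (v ∈? C)) (allFin n) ℕ.+ binom₂ ∣ C ∣ ≡⟨ first s ⟩
  binom₂ ∣ s ∷ C ∣ ∎
  where
  open ≡-Reasoning
  b = λ e → does (inside? (s ∷ C) e)
  rest = cartesianProduct (map suc (allFin n)) (zero ∷ map suc (allFin n))
  row : count b (map (zero ,_) (map suc (allFin n))) ≡
        count (λ v → does (zero ∈? (s ∷ C)) ∧ does (v ∈? C)) (allFin n)
  row = trans (count-map b (zero ,_) (map suc (allFin n))) (count-map (b ∘ (zero ,_)) suc (allFin n))
  first : ∀ s → count (λ v → does (zero ∈? (s ∷ C)) ∧ does (v ∈? C)) (allFin n) ℕ.+ binom₂ ∣ C ∣ ≡ binom₂ ∣ s ∷ C ∣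
  first inside  = cong (ℕ._+ binom₂ ∣ C ∣) (count-∈ C)
  first outside = cong (ℕ._+ binom₂ ∣ C ∣) (count-false (λ _ → refl) (allFin n))

-- Powers in an Archimedean ordered field

last-before-failure : ∀ {ℓ} {P : ℕ → Set ℓ} → (∀ j → Dec (P j)) → P 0 → ∀ J → ¬ P J → ∃[ j ] P j × ¬ P (suc j)
last-before-failure P? P0 zero    ¬PJ = contradiction P0 ¬PJ
last-before-failure P? P0 (suc J) ¬PJ with P? J
... | yes PJ = J , PJ , ¬PJ
... | no ¬PJ′ = last-before-failure P? P0 J ¬PJ′

module OrderedField {c ℓ₁ ℓ₂} (ℝ : Reals c ℓ₁ ℓ₂) where
  open Reals ℝ renaming (refl to ≈-refl; sym to ≈-sym; trans to ≈-trans)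
  open Exp semiring public using (_^_; ^-homo-*; ^-assocʳ; ^-congʳ)
  open Mult semiring using (×-congʳ; ×-comm-*)

  poset : Poset c ℓ₁ ℓ₂
  poset = record { isPartialOrder = IsDecTotalOrder.isPartialOrder isDecTotalOrder }

  open POReasoning poset

  +-monoˡ-≤ : ∀ x {y z} → y ≤ z → y + x ≤ z + x
  +-monoˡ-≤ x {y} {z} y≤z = begin
    y + x  ≈⟨ +-comm y x ⟩
    x + y  ≤⟨ +-monoʳ-≤ x y≤z ⟩
    x + z  ≈⟨ +-comm x z ⟩
    z + x  ∎

  +-cancelʳ-≤ : ∀ x {y z} → y + x ≤ z + x → y ≤ z
  +-cancelʳ-≤ x {y} {z} y+x≤z+x = begin
    y              ≈⟨ cancel y ⟨
    y + x + - x    ≤⟨ +-monoˡ-≤ (- x) y+x≤z+x ⟩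
    z + x + - x    ≈⟨ cancel z ⟩
    z              ∎
    where
    cancel : ∀ y → y + x + - x ≈ y
    cancel y = ≈-trans (+-assoc y x (- x)) (≈-trans (+-congˡ (-‿inverseʳ x)) (+-identityʳ y))

  x≤x+y : ∀ x {y} → 0# ≤ y → x ≤ x + y
  x≤x+y x 0≤y = ≤-respˡ-≈ (+-identityʳ x) (+-monoʳ-≤ x 0≤y)

  +-nonneg : ∀ {x y} → 0# ≤ x → 0# ≤ y → 0# ≤ x + y
  +-nonneg {x} 0≤x 0≤y = ≤-trans 0≤x (x≤x+y x 0≤y)

  [y-x]+x≈y : ∀ x y → (y - x) + x ≈ y
  [y-x]+x≈y x y = ≈-trans (+-assoc y (- x) x) (≈-trans (+-congˡ (-‿inverseˡ x)) (+-identityʳ y))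

  0≤y-x : ∀ {x y} → x ≤ y → 0# ≤ y - x
  0≤y-x {x} {y} x≤y = ≤-respˡ-≈ (-‿inverseʳ x) (+-monoˡ-≤ (- x) x≤y)

  *-monoˡ-≤ : ∀ {x} → 0# ≤ x → ∀ {y z} → y ≤ z → x * y ≤ x * z
  *-monoˡ-≤ {x} 0≤x {y} {z} y≤z = begin
    x * y                  ≤⟨ x≤x+y (x * y) (*-nonneg 0≤x (0≤y-x y≤z)) ⟩
    x * y + x * (z - y)    ≈⟨ distribˡ x y (z - y) ⟨
    x * (y + (z - y))      ≈⟨ *-congˡ (≈-trans (+-comm y (z - y)) ([y-x]+x≈y y z)) ⟩
    x * z                  ∎

  *-monoʳ-≤ : ∀ {x} → 0# ≤ x → ∀ {y z} → y ≤ z → y * x ≤ z * x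
  *-monoʳ-≤ {x} 0≤x {y} {z} y≤z = begin
    y * x  ≈⟨ *-comm y x ⟩
    x * y  ≤⟨ *-monoˡ-≤ 0≤x y≤z ⟩
    x * z  ≈⟨ *-comm x z ⟩
    z * x  ∎

  ·-nonneg : ∀ n {x} → 0# ≤ x → 0# ≤ n · x
  ·-nonneg zero    0≤x = ≤-refl
  ·-nonneg (suc n) 0≤x = +-nonneg 0≤x (·-nonneg n 0≤x)

  ·-nonpos : ∀ n {x} → x ≤ 0# → n · x ≤ 0#
  ·-nonpos zero    x≤0 = ≤-refl
  ·-nonpos (suc n) {x} x≤0 = begin
    x + n · x   ≤⟨ +-monoˡ-≤ (n · x) x≤0 ⟩
    0# + n · x  ≈⟨ +-identityˡ (n · x) ⟩
    n · x       ≤⟨ ·-nonpos n x≤0 ⟩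
    0#          ∎

  module _ (0≤1 : 0# ≤ 1#) where

    ^-nonneg : ∀ {x} → 0# ≤ x → ∀ n → 0# ≤ x ^ n
    ^-nonneg 0≤x zero    = 0≤1
    ^-nonneg 0≤x (suc n) = *-nonneg 0≤x (^-nonneg 0≤x n)

    ^-≤1 : ∀ {x} → 0# ≤ x → x ≤ 1# → ∀ n → x ^ n ≤ 1#
    ^-≤1 0≤x x≤1 zero    = ≤-refl
    ^-≤1 {x} 0≤x x≤1 (suc n) = begin
      x * x ^ n  ≤⟨ *-monoˡ-≤ 0≤x (^-≤1 0≤x x≤1 n) ⟩
      x * 1#     ≈⟨ *-identityʳ x ⟩
      x          ≤⟨ x≤1 ⟩
      1#         ∎

    ^-antitone : ∀ {x} → 0# ≤ x → x ≤ 1# → ∀ {m n} → m ℕ.≤ n → x ^ n ≤ x ^ m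
    ^-antitone {x} 0≤x x≤1 {m} {n} m≤n = begin
      x ^ n                   ≈⟨ ^-congʳ x (ℕ.m+[n∸m]≡n m≤n) ⟨
      x ^ (m ℕ.+ (n ℕ.∸ m))   ≈⟨ ^-homo-* x m (n ℕ.∸ m) ⟩
      x ^ m * x ^ (n ℕ.∸ m)   ≤⟨ *-monoˡ-≤ (^-nonneg 0≤x m) (^-≤1 0≤x x≤1 (n ℕ.∸ m)) ⟩
      x ^ m * 1#              ≈⟨ *-identityʳ (x ^ m) ⟩
      x ^ m                   ∎

    module Bernoulli {x ε} (0≤x : 0# ≤ x) (0≤ε : 0# ≤ ε) (x+ε≈1 : x + ε ≈ 1#) where

      x≤1 : x ≤ 1#
      x≤1 = ≤-respʳ-≈ x+ε≈1 (x≤x+y x 0≤ε)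

      1≤x^n+n·ε : ∀ n → 1# ≤ x ^ n + n · ε
      1≤x^n+n·ε zero    = ≤-reflexive (≈-sym (+-identityʳ 1#))
      1≤x^n+n·ε (suc n) = begin
        1#                                 ≈⟨ x+ε≈1 ⟨
        x + ε                              ≈⟨ +-congʳ (*-identityʳ x) ⟨
        x * 1# + ε                         ≤⟨ +-monoˡ-≤ ε (*-monoˡ-≤ 0≤x (1≤x^n+n·ε n)) ⟩
        x * (x ^ n + n · ε) + ε            ≈⟨ +-congʳ (distribˡ x (x ^ n) (n · ε)) ⟩
        x * x ^ n + x * (n · ε) + ε
          ≤⟨ +-monoˡ-≤ ε (+-monoʳ-≤ (x ^ suc n) (*-monoʳ-≤ (·-nonneg n 0≤ε) x≤1)) ⟩
        x * x ^ n + 1# * (n · ε) + ε       ≈⟨ +-congʳ (+-congˡ (*-identityˡ (n · ε))) ⟩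
        x * x ^ n + n · ε + ε              ≈⟨ +-assoc (x ^ suc n) (n · ε) ε ⟩
        x * x ^ n + (n · ε + ε)            ≈⟨ +-congˡ (+-comm (n · ε) ε) ⟩
        x ^ suc n + suc n · ε              ∎

      -- A division-free form of (1 - ε)ⁿ ≤ 1 / (1 + n ε), which drives the powers of x below every
      -- positive bound. For s = 1 + n ε the step is x (s + ε) ≤ s (x + ε) = s, by x ≤ 1 ≤ s.
      x^n*[1+n·ε]≤1 : ∀ n → x ^ n * (1# + n · ε) ≤ 1#
      x^n*[1+n·ε]≤1 zero    = ≤-reflexive (≈-trans (*-identityˡ _) (+-identityʳ 1#))
      x^n*[1+n·ε]≤1 (suc n) = begin
        x * x ^ n * (1# + (ε + n · ε))       ≈⟨ *-congʳ (*-comm x (x ^ n)) ⟩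
        x ^ n * x * (1# + (ε + n · ε))       ≈⟨ *-assoc (x ^ n) x _ ⟩
        x ^ n * (x * (1# + (ε + n · ε)))     ≈⟨ *-congˡ (*-congˡ (+-congˡ (+-comm ε (n · ε)))) ⟩
        x ^ n * (x * (1# + (n · ε + ε)))     ≈⟨ *-congˡ (*-congˡ (+-assoc 1# (n · ε) ε)) ⟨
        x ^ n * (x * (s + ε))                ≈⟨ *-congˡ (distribˡ x s ε) ⟩
        x ^ n * (x * s + x * ε)
          ≤⟨ *-monoˡ-≤ (^-nonneg 0≤x n) (+-monoʳ-≤ (x * s) (*-monoʳ-≤ 0≤ε x≤s)) ⟩
        x ^ n * (x * s + s * ε)              ≈⟨ *-congˡ (+-congʳ (*-comm x s)) ⟩
        x ^ n * (s * x + s * ε)              ≈⟨ *-congˡ (distribˡ s x ε) ⟨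
        x ^ n * (s * (x + ε))                ≈⟨ *-congˡ (≈-trans (*-congˡ x+ε≈1) (*-identityʳ s)) ⟩
        x ^ n * s                            ≤⟨ x^n*[1+n·ε]≤1 n ⟩
        1#                                   ∎
        where
        s = 1# + n · ε
        x≤s : x ≤ s
        x≤s = ≤-trans x≤1 (x≤x+y 1# (·-nonneg n 0≤ε))

  module _ {α} (0<α : 0# < α) (α<1 : α < 1#) where

    private
      0≤α = proj₁ 0<α
      α≤1 = proj₁ α<1

      0≤1 : 0# ≤ 1#
      0≤1 = ≤-trans 0≤α α≤1

      α≰0 : ¬ (α ≤ 0#)
      α≰0 α≤0 = proj₂ 0<α (≤-antisym 0≤α α≤0)

      δ = 1# - α

      δ+α≈1 : δ + α ≈ 1#
      δ+α≈1 = [y-x]+x≈y α 1#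

      0≤δ : 0# ≤ δ
      0≤δ = 0≤y-x α≤1

      δ≉0 : ¬ (δ ≈ 0#)
      δ≉0 δ≈0 = proj₂ α<1 (≈-trans (≈-sym (+-identityˡ α)) (≈-trans (+-congʳ (≈-sym δ≈0)) δ+α≈1))

    -- Bernoulli's inequality for x = 1 - ε with n ε = 1 - α.
    root-above : ∀ n → ∃[ x ] 0# ≤ x × x ≤ 1# × α ≤ x ^ suc n × ∃[ J ] ¬ (α ≤ x ^ J)
    root-above n with inverse (suc n · 1#) n·1≉0
      where
      n·1≉0 : ¬ (suc n · 1# ≈ 0#)
      n·1≉0 eq = 0≉1 (≤-antisym 0≤1 (≤-respʳ-≈ eq (x≤x+y 1# (·-nonneg n 0≤1))))
    ... | w , n·1*w≈1 = x , 0≤x , x≤1 , α≤x^n , J , α≰x^J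
      where
      ε = w * δ

      n·ε≈δ : suc n · ε ≈ δ
      n·ε≈δ = begin-equality
        suc n · ε               ≈⟨ ×-congʳ (suc n) (*-identityʳ ε) ⟨
        suc n · (ε * 1#)        ≈⟨ ×-comm-* (suc n) ε 1# ⟨
        ε * (suc n · 1#)        ≈⟨ *-comm ε _ ⟩
        (suc n · 1#) * (w * δ)  ≈⟨ *-assoc _ w δ ⟨
        (suc n · 1#) * w * δ    ≈⟨ *-congʳ n·1*w≈1 ⟩
        1# * δ                  ≈⟨ *-identityˡ δ ⟩
        δ                       ∎

      0≤ε : 0# ≤ ε
      -- No axiom speaks of the sign of an inverse. But ε ≤ 0 would make its multiple δ nonpositive,
      -- while δ = 1 - α is positive.
      0≤ε with ≤-total 0# ε
      ... | inj₁ 0≤ε = 0≤ε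
      ... | inj₂ ε≤0 = contradiction
        (≤-antisym (≤-respˡ-≈ n·ε≈δ (·-nonpos (suc n) ε≤0)) 0≤δ) δ≉0

      ε≉0 : ¬ (ε ≈ 0#)
      ε≉0 ε≈0 = δ≉0 (≤-antisym (≤-respˡ-≈ n·ε≈δ (·-nonpos (suc n) (≤-reflexive ε≈0))) 0≤δ)

      x = 1# - ε

      x+ε≈1 : x + ε ≈ 1#
      x+ε≈1 = [y-x]+x≈y ε 1#

      0≤x : 0# ≤ x
      -- In fact α ≤ x, because ε is at most its multiple δ = 1 - α.
      0≤x = ≤-trans 0≤α (+-cancelʳ-≤ ε (begin
        α + ε          ≤⟨ +-monoʳ-≤ α (x≤x+y ε (·-nonneg n 0≤ε)) ⟩
        α + suc n · ε  ≈⟨ +-congˡ n·ε≈δ ⟩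
        α + δ          ≈⟨ ≈-trans (+-comm α δ) δ+α≈1 ⟩
        1#             ≈⟨ x+ε≈1 ⟨
        x + ε          ∎))

      open Bernoulli 0≤1 0≤x 0≤ε x+ε≈1

      α≤x^n : α ≤ x ^ suc n
      α≤x^n = +-cancelʳ-≤ δ (begin
        α + δ                   ≈⟨ ≈-trans (+-comm α δ) δ+α≈1 ⟩
        1#                      ≤⟨ 1≤x^n+n·ε (suc n) ⟩
        x ^ suc n + suc n · ε   ≈⟨ +-congˡ n·ε≈δ ⟩
        x ^ suc n + δ           ∎)

      ε*α≉0 : ¬ (ε * α ≈ 0#)
      ε*α≉0 ε*α≈0 with inverse α (λ α≈0 → α≰0 (≤-reflexive α≈0))
      ... | v , α*v≈1 = ε≉0 (begin-equality
        ε            ≈⟨ *-identityʳ ε ⟨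
        ε * 1#       ≈⟨ *-congˡ α*v≈1 ⟨
        ε * (α * v)  ≈⟨ *-assoc ε α v ⟨
        ε * α * v    ≈⟨ *-congʳ ε*α≈0 ⟩
        0# * v       ≈⟨ zeroˡ v ⟩
        0#           ∎)

      -- J is at least 1 / (ε α), so α * (J · ε) ≥ 1. Then α ≤ x ^ J would give α + 1 ≤ x ^ J * (1 +
      -- J · ε) ≤ 1.
      z = proj₁ (inverse (ε * α) ε*α≉0)
      J = proj₁ (archimedean z)

      1≤α*J·ε : 1# ≤ α * (J · ε)
      1≤α*J·ε = begin
        1#                     ≈⟨ proj₂ (inverse (ε * α) ε*α≉0) ⟨
        ε * α * z              ≤⟨ *-monoˡ-≤ (*-nonneg 0≤ε 0≤α) (proj₂ (archimedean z)) ⟩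
        ε * α * (J · 1#)       ≈⟨ *-congʳ (*-comm ε α) ⟩
        α * ε * (J · 1#)       ≈⟨ *-assoc α ε _ ⟩
        α * (ε * (J · 1#))     ≈⟨ *-congˡ (×-comm-* J ε 1#) ⟩
        α * (J · (ε * 1#))     ≈⟨ *-congˡ (×-congʳ J (*-identityʳ ε)) ⟩
        α * (J · ε)            ∎

      α≰x^J : ¬ (α ≤ x ^ J)
      α≰x^J α≤x^J = α≰0 (+-cancelʳ-≤ 1# (begin
        α + 1#                    ≤⟨ +-monoʳ-≤ α 1≤α*J·ε ⟩
        α + α * (J · ε)           ≈⟨ +-congʳ (*-identityʳ α) ⟨
        α * 1# + α * (J · ε)      ≈⟨ distribˡ α 1# (J · ε) ⟨
        α * (1# + J · ε)          ≤⟨ *-monoʳ-≤ (+-nonneg 0≤1 (·-nonneg J 0≤ε)) α≤x^J ⟩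
        x ^ J * (1# + J · ε)      ≤⟨ x^n*[1+n·ε]≤1 J ⟩
        1#                        ≈⟨ +-identityˡ 1# ⟨
        0# + 1#                   ∎))

    -- For x with x ^ (a * a) ≥ α, the power p = x ^ j with x ^ (a * j) ≥ α
    -- and j maximal has j ≥ a, so a * suc j ≤ b * j.
    separating-power : ∀ {a b} → 1 ℕ.≤ a → a ℕ.< b →
                       ∃[ p ] 0# < p × p ≤ 1# × α ≤ p ^ a × ¬ (α ≤ p ^ b)
    -- The argument is a * a - 1, so that the exponent in `root-above` reduces to a * a.
    separating-power {suc a-1} {b} _ a<b = separate (root-above (a-1 ℕ.+ a-1 ℕ.* suc a-1))
      where
      a = suc a-1
      separate : ∃[ x ] 0# ≤ x × x ≤ 1# × α ≤ x ^ (a ℕ.* a) × ∃[ J ] ¬ (α ≤ x ^ J) →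
                 ∃[ p ] 0# < p × p ≤ 1# × α ≤ p ^ a × ¬ (α ≤ p ^ b)
      separate (x , 0≤x , x≤1 , α≤x^a² , J , α≰x^J) =
        p , (0≤p , 0≉p) , ^-≤1 0≤1 0≤x x≤1 j , α≤p^a , α≰p^b
        where
        crossing : ∃[ j ] α ≤ x ^ (j ℕ.* a) × ¬ (α ≤ x ^ (suc j ℕ.* a))
        crossing = last-before-failure (λ j → α ≤? x ^ (j ℕ.* a)) α≤1 J
          (λ α≤ → α≰x^J (≤-trans α≤ (^-antitone 0≤1 0≤x x≤1 (ℕ.m≤m*n J a))))

        j = proj₁ crossing
        p = x ^ j

        α≰x^[1+j]a : ¬ (α ≤ x ^ (suc j ℕ.* a))
        α≰x^[1+j]a = proj₂ (proj₂ crossing)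

        0≤p : 0# ≤ p
        0≤p = ^-nonneg 0≤1 0≤x j

        α≤p^a : α ≤ p ^ a
        α≤p^a = ≤-respʳ-≈ (≈-sym (^-assocʳ x j a)) (proj₁ (proj₂ crossing))

        0≉p : ¬ (0# ≈ p)
        0≉p 0≈p = α≰0 (≤-trans α≤p^a (≤-reflexive (≈-trans (*-congʳ (≈-sym 0≈p)) (zeroˡ (p ^ a-1)))))

        a≤j : a ℕ.≤ j
        a≤j = ℕ.≮⇒≥ λ j<a → α≰x^[1+j]a
          (≤-trans α≤x^a² (^-antitone 0≤1 0≤x x≤1 (ℕ.*-monoˡ-≤ a j<a)))

        [1+j]a≤jb : suc j ℕ.* a ℕ.≤ j ℕ.* b
        [1+j]a≤jb = ℕ.≤-trans (ℕ.+-monoˡ-≤ (j ℕ.* a) a≤j)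
          (ℕ.≤-trans (ℕ.≤-reflexive (sym (ℕ.*-suc j a))) (ℕ.*-monoʳ-≤ j a<b))

        α≰p^b : ¬ (α ≤ p ^ b)
        α≰p^b α≤p^b = α≰x^[1+j]a
          (≤-trans (≤-respʳ-≈ (^-assocʳ x j b) α≤p^b) (^-antitone 0≤1 0≤x x≤1 [1+j]a≤jb))

-- Clique probabilities

module _ {c ℓ₁ ℓ₂} (ℝ : Reals c ℓ₁ ℓ₂) where
  open Reals ℝ renaming (refl to ≈-refl; sym to ≈-sym; trans to ≈-trans)
  open OrderedField ℝ
  open UncertainGraphs ℝ

  module Sampling {n : ℕ} (x : Carrier) where

    open SetoidReasoning setoid

    w : Edge n → Carrier
    w _ = x

    -- The sum in `clq` for an arbitrary event `b`: the induction over the edges leads to events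
    -- such as `b ∘ (e ∷_)`.
    total : List (List (Edge n) × Carrier) → (List (Edge n) → Bool) → Carrier
    total samples b = foldr _+_ 0# (map (λ (S , q) → if b S then q else 0#) samples)

    total-++ : ∀ ss ts b → total (ss ++ ts) b ≈ total ss b + total ts b
    total-++ []             ts b = ≈-sym (+-identityˡ _)
    total-++ ((S , q) ∷ ss) ts b = ≈-trans (+-congˡ (total-++ ss ts b)) (≈-sym (+-assoc _ _ _))

    total-map : ∀ (f : List (Edge n) → List (Edge n)) y ss b →
                total (map (λ (S , q) → f S , y * q) ss) b ≈ y * total ss (b ∘ f)
    total-map f y []             b = ≈-sym (zeroʳ y)
    total-map f y ((S , q) ∷ ss) b = ≈-trans (+-cong head (total-map f y ss b)) (≈-sym (distribˡ y _ _))
      where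
      head : (if b (f S) then y * q else 0#) ≈ y * (if b (f S) then q else 0#)
      head with b (f S)
      ... | true  = ≈-refl
      ... | false = ≈-sym (zeroʳ y)

    -- The law of total probability, conditioning on whether `e` is sampled.
    total-∷ : ∀ e es b → total (sample w (e ∷ es)) b ≈
              x * total (sample w es) (b ∘ (e ∷_)) + (1# - x) * total (sample w es) b
    total-∷ e es b = ≈-trans (total-++ (map (λ (S , q) → e ∷ S , x * q) (sample w es)) _ b)
      (+-cong (total-map (e ∷_) x (sample w es) b) (total-map id (1# - x) (sample w es) b))

    total-false : ∀ es b → (∀ S → S ⊆ es → b S ≡ false) → total (sample w es) b ≈ 0#
    total-false []       b b≡false rewrite b≡false [] id = +-identityʳ 0#
    total-false (e ∷ es) b b≡false = begin
      total (sample w (e ∷ es)) b ≈⟨ total-∷ e es b ⟩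
      x * total (sample w es) (b ∘ (e ∷_)) + (1# - x) * total (sample w es) b
        ≈⟨ +-cong (*-congˡ (total-false es (b ∘ (e ∷_)) (λ S S⊆es → b≡false (e ∷ S) (∷⁺ʳ e S⊆es))))
                  (*-congˡ (total-false es b (λ S S⊆es → b≡false S (there ∘ S⊆es)))) ⟩
      x * 0# + (1# - x) * 0#      ≈⟨ +-cong (zeroʳ x) (zeroʳ (1# - x)) ⟩
      0# + 0#                     ≈⟨ +-identityʳ 0# ⟩
      0#                          ∎

    -- D holds of the edges already known to be in the sample.
    total-⊇ : ∀ {ℓ} {R : Pred (Edge n) ℓ} (R? : Decidable R) (D : Edge n → Set) {P : List (Edge n) → Set}
              (P? : Decidable P) es → Unique es →
              (∀ {S} → P S → ∀ {e} → R e → D e ⊎ e ∈ᴱ S) →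
              (∀ {S} → (∀ {e} → R e → D e ⊎ e ∈ᴱ S) → P S) →
              All (¬_ ∘ D) es → (∀ {e} → R e → D e ⊎ e ∈ᴱ es) →
              total (sample w es) (does ∘ P?) ≈ x ^ length (filter R? es)
    total-⊇ R? D P? [] _ P⇒ ⇒P D∌es R⊆ rewrite dec-true (P? []) (⇒P R⊆) = +-identityʳ 1#
    total-⊇ {R = R} R? D {P} P? (e ∷ es) (e≢ ∷ unique) P⇒ ⇒P (¬De ∷ D∌es) R⊆ =
      ≈-trans (total-∷ e es (does ∘ P?)) (≈-trans (+-congʳ (*-congˡ with-e)) without-e)
      where
      -- In the branch where `e` is sampled, it joins the known edges, and the event is read as one
      -- about the remaining edges.
      D′ : Edge n → Set
      D′ e′ = D e′ ⊎ e′ ≡ e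

      regroup : ∀ {e′ S} → D e′ ⊎ e′ ∈ᴱ e ∷ S → D′ e′ ⊎ e′ ∈ᴱ S
      regroup (inj₁ De′)         = inj₁ (inj₁ De′)
      regroup (inj₂ (here eq))   = inj₁ (inj₂ eq)
      regroup (inj₂ (there e′∈)) = inj₂ e′∈

      regroup⁻¹ : ∀ {e′ S} → D′ e′ ⊎ e′ ∈ᴱ S → D e′ ⊎ e′ ∈ᴱ e ∷ S
      regroup⁻¹ (inj₁ (inj₁ De′)) = inj₁ De′
      regroup⁻¹ (inj₁ (inj₂ eq))  = inj₂ (here eq)
      regroup⁻¹ (inj₂ e′∈)        = inj₂ (there e′∈)

      k = length (filter R? es)

      with-e : total (sample w es) (does ∘ P? ∘ (e ∷_)) ≈ x ^ k
      with-e = total-⊇ R? D′ (P? ∘ (e ∷_)) es unique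
        (λ PS Re′ → regroup (P⇒ PS Re′)) (λ R⇒ → ⇒P (λ Re′ → regroup⁻¹ (R⇒ Re′)))
        (All.zipWith (λ { (¬D , e≢e′) (inj₁ De′) → ¬D De′ ; (¬D , e≢e′) (inj₂ eq) → e≢e′ (sym eq) }) (D∌es , e≢))
        (λ Re′ → regroup (R⊆ Re′))

      without-e : x * x ^ k + (1# - x) * total (sample w es) (does ∘ P?) ≈ x ^ length (filter R? (e ∷ es))
      without-e with R? e
      -- A required edge must be sampled: as `es` has no second copy of `e` and `D` does not hold of
      -- it, the other branch has probability 0.
      ... | yes Re = begin
        x * x ^ k + (1# - x) * total (sample w es) (does ∘ P?)
          ≈⟨ +-congˡ (*-congˡ (total-false es (does ∘ P?) (λ S S⊆es → dec-false (P? S) (e∉ S S⊆es)))) ⟩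
        x * x ^ k + (1# - x) * 0#   ≈⟨ +-congˡ (zeroʳ (1# - x)) ⟩
        x * x ^ k + 0#              ≈⟨ +-identityʳ _ ⟩
        x * x ^ k                   ∎
        where
        e∉ : ∀ S → S ⊆ es → ¬ P S
        e∉ S S⊆es PS with P⇒ PS Re
        ... | inj₁ De  = ¬De De
        ... | inj₂ e∈S = All.lookup e≢ (S⊆es e∈S) refl
      -- An edge outside `R` does not affect the event: both branches give `x ^ k`, and their
      -- weights sum to 1.
      ... | no ¬Re = begin
        x * x ^ k + (1# - x) * total (sample w es) (does ∘ P?)
          ≈⟨ +-congˡ (*-congˡ (total-⊇ R? D P? es unique P⇒ ⇒P D∌es R⊆es)) ⟩
        x * x ^ k + (1# - x) * x ^ k   ≈⟨ distribʳ (x ^ k) x (1# - x) ⟨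
        (x + (1# - x)) * x ^ k         ≈⟨ *-congʳ (≈-trans (+-comm x (1# - x)) ([y-x]+x≈y x 1#)) ⟩
        1# * x ^ k                     ≈⟨ *-identityˡ _ ⟩
        x ^ k                          ∎
        where
        R⊆es : ∀ {e′} → R e′ → D e′ ⊎ e′ ∈ᴱ es
        R⊆es Re′ with R⊆ Re′
        ... | inj₁ De′            = inj₁ De′
        ... | inj₂ (here refl)  = contradiction Re′ ¬Re
        ... | inj₂ (there e′∈)    = inj₂ e′∈

  module Complete (n : ℕ) (x : Carrier) (0<x : 0# < x) (x≤1 : x ≤ 1#) where

    completeGraph : UncertainGraph n
    completeGraph = record
      { Γ        = λ u → ∁ ⁅ u ⁆
      ; Γ-sym    = λ {u} {v} v∈ → x∉p⇒x∈∁p λ u∈ → x∈∁p⇒x∉p v∈ (subst (_∈ ⁅ u ⁆) (x∈⁅y⁆⇒x≡y v u∈) (x∈⁅x⁆ u))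
      ; Γ-irrefl = λ {u} u∈ → x∈∁p⇒x∉p u∈ (x∈⁅x⁆ u)
      ; p        = λ _ _ → x
      ; p-sym    = λ _ → ≈-refl
      ; 0<p      = λ _ → 0<x
      ; p≤1      = λ _ → x≤1
      }

    <⇒∈Γ : ∀ {u v : Fin n} → u Fin.< v → v ∈ ∁ ⁅ u ⁆
    <⇒∈Γ {u} u<v = x∉p⇒x∈∁p λ v∈ → ℕ.<-irrefl (cong Fin.toℕ (sym (x∈⁅y⁆⇒x≡y u v∈))) u<v

    -- The required edges are the pairs inside `C`, all of them edges of the complete graph, and
    -- initially none is known. As `Inside` implies both conditions by which `edges` filters, they
    -- disappear from the count.
    clq≈ : ∀ C → clq C completeGraph ≈ x ^ binom₂ ∣ C ∣
    clq≈ C = ≈-trans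
      (total-⊇ (inside? C) (λ _ → ⊥) (isClique? C) (edges completeGraph) unique
        (λ clique {(u , v)} (u<v , u∈C , v∈C) → inj₂ (clique u v u∈C v∈C u<v))
        (λ R⇒ u v u∈C v∈C u<v → fromInj₂ (λ ()) (R⇒ (u<v , u∈C , v∈C)))
        (All.universal (λ _ ()) (edges completeGraph))
        (λ {(u , v)} (u<v , _) → inj₂ (∈-filter⁺ _ (∈-filter⁺ _ (∈-cartesianProduct⁺ (∈-allFin u) (∈-allFin v)) u<v) (<⇒∈Γ u<v))))
      (^-congʳ x size)
      where
      open Sampling {n} x
      unique : Unique (edges completeGraph)
      unique = Unique.filter⁺ _ (Unique.filter⁺ _ (Unique.cartesianProduct⁺ (Unique.allFin⁺ n) (Unique.allFin⁺ n)))

      pairs = cartesianProduct (allFin n) (allFin n)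
      size : length (filter (inside? C) (edges completeGraph)) ≡ binom₂ ∣ C ∣
      size = begin
        length (filter (inside? C) (edges completeGraph))
          ≡⟨ cong length (filter-filter-⇒ (inside? C) _ (<⇒∈Γ ∘ proj₁) (filter (λ (u , v) → u Fin.<? v) pairs)) ⟩
        length (filter (inside? C) (filter (λ (u , v) → u Fin.<? v) pairs))
          ≡⟨ cong length (filter-filter-⇒ (inside? C) _ proj₁ pairs) ⟩
        length (filter (inside? C) pairs)   ≡⟨ length-filter (inside? C) pairs ⟩
        count (does ∘ inside? C) pairs      ≡⟨ count-inside C ⟩
        binom₂ ∣ C ∣                        ∎
        where open ≡-Reasoning

-- The running time of MULE

module _ {c ℓ₁ ℓ₂} (ℝ : Reals c ℓ₁ ℓ₂) where
  open Reals ℝ using (Carrier; _*_; _≤?_; 1#)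
  open UncertainGraphs ℝ
  module RunningTime (κ : ℕ) {n : ℕ} (α : Carrier) (𝒢 : UncertainGraph n) where
    open Algorithm κ α 𝒢
    open UncertainGraph 𝒢 using (p)

    Rec : Pairs → Set
    Rec I = ∀ {m} → m ℕ.< length I → Acc ℕ._<_ m

    -- One iteration of the loop in `enum`, with the later iterations abstracted into `rest`. The
    -- equation produced by `remember` is `refl`, so the `subst` of `enum` disappears and the two
    -- agree definitionally.
    visit : (C : Subset n) (q : Carrier) (I X : Pairs) → Rec I →
            ∀ {u r} → (u , r) List.∈ I → Timed (List (Subset n)) → Timed (List (Subset n))
    visit C q I X rec {u} {r} u∈I rest = do
      setOperation 1
      elementary 1
      let C′ = C ∪ ⁅ u ⁆
      elementary 1
      let q′ = q * r
      generateI C′ q′ I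
      X′ ← generateX C′ q′ X
      found ← enum C′ q′ (value (generateI C′ q′ I)) X′ (rec (generateI-< C q′ I u∈I))
      elementary 1
      others ← rest
      return (found ++ others)

    -- The local function loop of enum has no name outside enum. Here it is the
    -- solution of a metavariable that the type checker finds from enum-∷, where
    -- loop appears applied to distinct variables after the with-abstractions.
    mutual
      loop : (C : Subset n) (q : Carrier) (I X : Pairs) → Rec I →
             (J : Pairs) → (∀ {x} → x List.∈ J → x List.∈ I) → Pairs → Timed (List (Subset n))
      loop = _

      enum-∷ : ∀ C q u r J X (g : (I : Pairs) → Rec I) →
        let I = (u , r) ∷ J in
        enum C q I X (acc (g I)) ≡
          (do isEmpty I
              isEmpty X
              visit C q I X (g I) (here refl) (loop C q I X (g I) J there ((u , r) ∷ X)))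
      enum-∷ C q u r J X g
        with (u , r) ∷ X
           | (u , r) ∷ J
           | (λ {x} (x∈J : x List.∈ J) → there {x = (u , r)} {xs = J} x∈J)
           | id {A = (u , r) List.∈ ((u , r) ∷ J)} (here refl)
      -- As `g` is given for every list, `g I` stays well typed once the list has become a variable,
      -- and can be abstracted in turn.
      ... | Y | I | J⊆I | u∈I with (λ {m} → g I {m})
      ...   | rec = refl

    module _ {test : Fin n → Timed Bool} {m : Fin n} {q : Carrier} where

      -- 7 = 2 + 4 + 1: the test, the lookup with its arithmetic and comparison, and the insertion.
      select-steps : (∀ u → steps (test u) ℕ.≤ κ ℕ.* 2) →
                     ∀ I → steps (select test m q I) ℕ.≤ κ ℕ.* 7 ℕ.* length I
      select-steps test≤ []            = z≤n
      select-steps test≤ ((u , r) ∷ I) = begin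
        steps (select test m q ((u , r) ∷ I))  ≤⟨ step≤ ⟩
        steps (select test m q I) ℕ.+ κ ℕ.* 7  ≤⟨ ℕ.+-monoˡ-≤ _ (select-steps test≤ I) ⟩
        κ ℕ.* 7 ℕ.* length I ℕ.+ κ ℕ.* 7       ≡⟨ ℕ.+-comm _ (κ ℕ.* 7) ⟩
        κ ℕ.* 7 ℕ.+ κ ℕ.* 7 ℕ.* length I       ≡⟨ ℕ.*-suc (κ ℕ.* 7) (length I) ⟨
        κ ℕ.* 7 ℕ.* suc (length I)             ∎
        where
        open ℕ.≤-Reasoning
        rest = steps (select test m q I)
        step≤ : steps (select test m q ((u , r) ∷ I)) ℕ.≤ rest ℕ.+ κ ℕ.* 7
        step≤ with value (test u)
        ... | false = ℕ.+-monoʳ-≤ rest (ℕ.≤-trans (ℕ.≤-reflexive (ℕ.+-identityʳ _))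
                        (ℕ.≤-trans (test≤ u) (ℕ.*-monoʳ-≤ κ (ℕ.m≤m+n 2 5))))
        ... | true with does (α ≤? q * (r * p u m))
        ...   | false = ℕ.+-monoʳ-≤ rest (ℕ.≤-trans (ℕ.+-monoˡ-≤ (κ ℕ.* 4 ℕ.+ 0) (test≤ u))
                          (ℕ.≤-trans (ℕ.m≤m+n _ κ) (ℕ.≤-reflexive (eq κ))))
          where
          eq : ∀ κ → κ ℕ.* 2 ℕ.+ (κ ℕ.* 4 ℕ.+ 0) ℕ.+ κ ≡ κ ℕ.* 7
          eq = solve-∀
        ...   | true  = ℕ.+-monoʳ-≤ rest (ℕ.≤-trans (ℕ.+-monoˡ-≤ (κ ℕ.* 4 ℕ.+ (κ ℕ.* 1 ℕ.+ 0)) (test≤ u))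
                          (ℕ.≤-reflexive (eq κ)))
          where
          eq : ∀ κ → κ ℕ.* 2 ℕ.+ (κ ℕ.* 4 ℕ.+ (κ ℕ.* 1 ℕ.+ 0)) ≡ κ ℕ.* 7
          eq = solve-∀

      select-All : ∀ {ℓ} {Q : Fin n → Set ℓ} {I} → All (Q ∘ proj₁) I → All (Q ∘ proj₁) (value (select test m q I))
      select-All []                             = []
      select-All {I = (u , r) ∷ I} (Qu ∷ QI) with value (test u)
      ... | false = select-All QI
      ... | true with does (α ≤? q * (r * p u m))
      ...   | false = select-All QI
      ...   | true  = Qu ∷ select-All QI

      select-++-≤ : ∀ P {x} J → All (λ y → value (test (proj₁ y)) ≡ false) P → value (test (proj₁ x)) ≡ false →
                    length (value (select test m q (P ++ x ∷ J))) ℕ.≤ length J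
      select-++-≤ [] {x} J [] eq with value (test (proj₁ x))
      ... | false = select-≤ test m q J
      select-++-≤ (y ∷ P) J (eq ∷ eqs) eq′ with value (test (proj₁ y))
      ... | false = select-++-≤ P J eqs eq′

    _<₁_ : Fin n × Carrier → Fin n × Carrier → Set
    x <₁ y = proj₁ x Fin.< proj₁ y

    Increasing : Pairs → Set c
    Increasing = AllPairs _<₁_

    select-Increasing : ∀ {test m q I} → Increasing I → Increasing (value (select test m q I))
    select-Increasing []                                               = []
    select-Increasing {test} {m} {q} {(u , r) ∷ I} (u<I ∷ I-inc) with value (test u)
    ... | false = select-Increasing I-inc
    ... | true with does (α ≤? q * (r * p u m))
    ...   | false = select-Increasing I-inc
    ...   | true  = select-All u<I ∷ select-Increasing I-inc

    generateI-Increasing : ∀ C q {I} → Increasing I → Increasing (value (generateI C q I))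
    generateI-Increasing C q I-inc with max C
    ... | nothing = []
    ... | just m  = select-Increasing I-inc

    -- 10 = 3 + 7: three set operations, and 7 elementary ones for each of at most n pairs.
    generate-overhead : ∀ {s} l → l ℕ.≤ n → s ℕ.≤ κ ℕ.* 7 ℕ.* l → κ ℕ.* n ℕ.* 3 ℕ.+ s ℕ.≤ κ ℕ.* n ℕ.* 10
    generate-overhead {s} l l≤n s≤ = begin
      κ ℕ.* n ℕ.* 3 ℕ.+ s               ≤⟨ ℕ.+-monoʳ-≤ (κ ℕ.* n ℕ.* 3) s≤ ⟩
      κ ℕ.* n ℕ.* 3 ℕ.+ κ ℕ.* 7 ℕ.* l   ≤⟨ ℕ.+-monoʳ-≤ (κ ℕ.* n ℕ.* 3) (ℕ.*-monoʳ-≤ (κ ℕ.* 7) l≤n) ⟩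
      κ ℕ.* n ℕ.* 3 ℕ.+ κ ℕ.* 7 ℕ.* n   ≡⟨ eq κ n ⟩
      κ ℕ.* n ℕ.* 10                    ∎
      where
      open ℕ.≤-Reasoning
      eq : ∀ κ n → κ ℕ.* n ℕ.* 3 ℕ.+ κ ℕ.* 7 ℕ.* n ≡ κ ℕ.* n ℕ.* 10
      eq = solve-∀

    generateI-steps : ∀ C q I → length I ℕ.≤ n → steps (generateI C q I) ℕ.≤ κ ℕ.* n ℕ.* 10
    generateI-steps C q I I≤n with max C
    ... | nothing = generate-overhead (length I) I≤n z≤n
    ... | just m  = generate-overhead (length I) I≤n
                      (select-steps (λ u → ℕ.≤-reflexive (ℕ.+-identityʳ (κ ℕ.* 2))) I)

    generateX-steps : ∀ C q X → length X ℕ.≤ n → steps (generateX C q X) ℕ.≤ κ ℕ.* n ℕ.* 10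
    generateX-steps C q X X≤n with max C
    ... | nothing = generate-overhead (length X) X≤n z≤n
    ... | just m  = generate-overhead (length X) X≤n
                      (select-steps (λ u → ℕ.≤-trans (ℕ.≤-reflexive (ℕ.+-identityʳ (κ ℕ.* 1))) (ℕ.*-monoʳ-≤ κ (ℕ.n≤1+n 1))) X)

    generateX-≤ : ∀ C q X → length (value (generateX C q X)) ℕ.≤ length X
    generateX-≤ C q X with max C
    ... | nothing = z≤n
    ... | just m  = select-≤ _ m q X

    -- The maximum m of `C ∪ ⁅ u ⁆` is at least u, so u and all earlier vertices fail the test m <
    -- v. Only pairs of `J` can survive, which is what bounds the recursion by powers of 2.
    generateI-≤ : ∀ C q P {u r} J → All (_<₁ (u , r)) P →
                  length (value (generateI (C ∪ ⁅ u ⁆) q (P ++ (u , r) ∷ J))) ℕ.≤ length J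
    generateI-≤ C q P {u} {r} J P<u with max (C ∪ ⁅ u ⁆) in eq
    ... | nothing = z≤n
    ... | just m  = select-++-≤ P J (All.map (λ v<u → m≮ (ℕ.<⇒≤ v<u)) P<u) (m≮ ℕ.≤-refl)
      where
      m≮ : ∀ {v b} → v Fin.≤ u → does (m Fin.<? v) ∧ b ≡ false
      m≮ {v} {b} v≤u = cong (_∧ b) (dec-false (m Fin.<? v)
        (ℕ.≤⇒≯ (ℕ.≤-trans v≤u (∈⇒≤max (C ∪ ⁅ u ⁆) (q⊆p∪q C ⁅ u ⁆ (x∈⁅x⁆ u)) eq))))

    -- A bound for the cost of one call of enum and for that of one iteration
    -- of its loop, both without the recursive calls.
    unit : ℕ
    unit = κ ℕ.* (21 ℕ.* n ℕ.+ 3)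

    -- 21 = 1 + 10 + 10 counts the copy of `C` and the two generators. The 3 elementary operations
    -- are the insertion of u into `C`, the product for `q′`, and the insertion into X.
    visit-steps : ∀ C q I X (rec : Rec I) {u r} (u∈I : (u , r) List.∈ I) rest →
      length I ℕ.≤ n → length X ℕ.≤ n →
      let C′ = C ∪ ⁅ u ⁆ ; q′ = q * r
          found = enum C′ q′ (value (generateI C′ q′ I)) (value (generateX C′ q′ X))
                    (rec (generateI-< C q′ I u∈I)) in
      steps (visit C q I X rec u∈I rest) ℕ.≤ unit ℕ.+ (steps found ℕ.+ steps rest)
    visit-steps C q I X rec {u} {r} u∈I rest I≤n X≤n =
      ℕ.≤-trans
        (ℕ.+-monoʳ-≤ (κ ℕ.* n ℕ.* 1) (ℕ.+-monoʳ-≤ (κ ℕ.* 1) (ℕ.+-monoʳ-≤ (κ ℕ.* 1)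
          (ℕ.+-mono-≤ (generateI-steps (C ∪ ⁅ u ⁆) (q * r) I I≤n) (ℕ.+-monoˡ-≤ _ (generateX-steps (C ∪ ⁅ u ⁆) (q * r) X X≤n))))))
        (ℕ.≤-reflexive (eq κ n _ (steps rest)))
      where
      eq : ∀ κ n f s →
        κ ℕ.* n ℕ.* 1 ℕ.+ (κ ℕ.* 1 ℕ.+ (κ ℕ.* 1 ℕ.+ (κ ℕ.* n ℕ.* 10 ℕ.+ (κ ℕ.* n ℕ.* 10 ℕ.+
          (f ℕ.+ (κ ℕ.* 1 ℕ.+ (s ℕ.+ 0)))))))
        ≡ κ ℕ.* (21 ℕ.* n ℕ.+ 3) ℕ.+ (f ℕ.+ s)
      eq = solve-∀

    mutual
      -- The cost T of a call with ∣ I ∣ = l satisfies T l ≤ unit + the sum over i < l of unit + T i, and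
      -- T l + unit = 2 ^ (l + 1) * unit solves this with equality.
      enum-steps : ∀ C q I X (a : Acc ℕ._<_ (length I)) → Increasing I → length I ℕ.+ length X ℕ.≤ n →
                   steps (enum C q I X a) ℕ.+ unit ℕ.≤ 2 ℕ.^ suc (length I) ℕ.* unit
      enum-steps C q [] [] (acc rec) I-inc I+X≤n = begin
        κ ℕ.* 1 ℕ.+ 0 ℕ.+ (κ ℕ.* 1 ℕ.+ 0 ℕ.+ (κ ℕ.* ∣ C ∣ ℕ.+ 0)) ℕ.+ unit ≡⟨ eq κ ∣ C ∣ unit ⟩
        κ ℕ.* (∣ C ∣ ℕ.+ 2) ℕ.+ unit
          ≤⟨ ℕ.+-monoˡ-≤ unit (ℕ.*-monoʳ-≤ κ
               (ℕ.+-mono-≤ (ℕ.≤-trans (∣p∣≤n C) (ℕ.m≤m+n n (20 ℕ.* n))) (ℕ.n≤1+n 2))) ⟩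
        unit ℕ.+ unit ≡⟨ cong (unit ℕ.+_) (ℕ.+-identityʳ unit) ⟨
        2 ℕ.* unit ∎
        where
        open ℕ.≤-Reasoning
        eq : ∀ κ c u → κ ℕ.* 1 ℕ.+ 0 ℕ.+ (κ ℕ.* 1 ℕ.+ 0 ℕ.+ (κ ℕ.* c ℕ.+ 0)) ℕ.+ u ≡ κ ℕ.* (c ℕ.+ 2) ℕ.+ u
        eq = solve-∀
      enum-steps C q [] (x ∷ X) (acc rec) I-inc I+X≤n = enum-steps′ C q [] (x ∷ X) rec I-inc I+X≤n
      enum-steps C q (x ∷ I) X (acc rec) I-inc I+X≤n = enum-steps′ C q (x ∷ I) X rec I-inc I+X≤n

      -- The common form of the two cases in which `enum` reaches its loop; the leading summands are
      -- the emptiness tests.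
      enum-steps′ : ∀ C q I X (rec : Rec I) → Increasing I → length I ℕ.+ length X ℕ.≤ n →
        κ ℕ.* 1 ℕ.+ 0 ℕ.+ (κ ℕ.* 1 ℕ.+ 0 ℕ.+ steps (loop C q I X rec I id X)) ℕ.+ unit
          ℕ.≤ 2 ℕ.^ suc (length I) ℕ.* unit
      enum-steps′ C q I X rec I-inc I+X≤n = begin
        κ ℕ.* 1 ℕ.+ 0 ℕ.+ (κ ℕ.* 1 ℕ.+ 0 ℕ.+ s) ℕ.+ unit ≡⟨ eq κ s unit ⟩
        s ℕ.+ (κ ℕ.* 2 ℕ.+ unit)
          ≤⟨ ℕ.+-monoʳ-≤ s (ℕ.+-monoˡ-≤ unit (ℕ.*-monoʳ-≤ κ (ℕ.≤-trans (ℕ.n≤1+n 2) (ℕ.m≤n+m 3 (21 ℕ.* n))))) ⟩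
        s ℕ.+ (unit ℕ.+ unit)
          ≤⟨ loop-steps C q I X rec [] I id X refl I-inc I-inc [] (ℕ.≤-trans (ℕ.m≤m+n _ _) I+X≤n) I+X≤n ⟩
        2 ℕ.^ suc (length I) ℕ.* unit ∎
        where
        open ℕ.≤-Reasoning
        s = steps (loop C q I X rec I id X)
        eq : ∀ κ s u → κ ℕ.* 1 ℕ.+ 0 ℕ.+ (κ ℕ.* 1 ℕ.+ 0 ℕ.+ s) ℕ.+ u ≡ s ℕ.+ (κ ℕ.* 2 ℕ.+ u)
        eq = solve-∀

      -- `P` holds the vertices already visited. They are still in the list `I` passed to
      -- `generateI`, and the order ensures that it discards them. Each iteration moves a vertex
      -- from `J` to `Y`, so the bound n on the sum of their lengths persists and keeps `generateX`
      -- at O(n). The call for u and the remaining iterations obey the same bound in `length J`,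
      -- hence the doubling.
      loop-steps : ∀ C q I X (rec : Rec I) P J (J⊆I : ∀ {x} → x List.∈ J → x List.∈ I) Y →
        I ≡ P ++ J → Increasing I → Increasing J → All (λ x → All (x <₁_) J) P →
        length I ℕ.≤ n → length J ℕ.+ length Y ℕ.≤ n →
        steps (loop C q I X rec J J⊆I Y) ℕ.+ (unit ℕ.+ unit) ℕ.≤ 2 ℕ.^ suc (length J) ℕ.* unit
      loop-steps C q I X rec P [] J⊆I Y I≡ I-inc J-inc P<J I≤n J+Y≤n =
        ℕ.≤-reflexive (cong (unit ℕ.+_) (sym (ℕ.+-identityʳ unit)))
      loop-steps C q I X rec P ((u , r) ∷ J) J⊆I Y I≡ I-inc (u<J ∷ J-inc) P<J I≤n J+Y≤n = begin
        steps (loop C q I X rec ((u , r) ∷ J) J⊆I Y) ℕ.+ (unit ℕ.+ unit)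
          ≤⟨ ℕ.+-monoˡ-≤ _ (visit-steps C q I Y rec (J⊆I (here refl)) rest I≤n
               (ℕ.≤-trans (ℕ.m≤n+m _ _) J+Y≤n)) ⟩
        unit ℕ.+ (e ℕ.+ steps rest) ℕ.+ (unit ℕ.+ unit) ≡⟨ eq unit e (steps rest) ⟩
        (e ℕ.+ unit) ℕ.+ (steps rest ℕ.+ (unit ℕ.+ unit)) ≤⟨ ℕ.+-mono-≤ e≤ rest≤ ⟩
        2 ℕ.^ suc (length J) ℕ.* unit ℕ.+ 2 ℕ.^ suc (length J) ℕ.* unit
          ≡⟨ double (2 ℕ.^ suc (length J)) unit ⟨
        2 ℕ.^ suc (suc (length J)) ℕ.* unit ∎
        where
        open ℕ.≤-Reasoning
        C′ = C ∪ ⁅ u ⁆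
        q′ = q * r
        I′ = value (generateI C′ q′ I)
        Y′ = value (generateX C′ q′ Y)
        e  = steps (enum C′ q′ I′ Y′ (rec (generateI-< C q′ I (J⊆I (here refl)))))
        rest = loop C q I X rec J (J⊆I ∘ there) ((u , r) ∷ Y)

        I′≤J : length I′ ℕ.≤ length J
        I′≤J = subst (λ L → length (value (generateI C′ q′ L)) ℕ.≤ length J) (sym I≡)
                 (generateI-≤ C q′ P J (All.map All.head P<J))

        J+1+Y≤n : length J ℕ.+ suc (length Y) ℕ.≤ n
        J+1+Y≤n = ℕ.≤-trans (ℕ.≤-reflexive (ℕ.+-suc _ _)) J+Y≤n

        e≤ : e ℕ.+ unit ℕ.≤ 2 ℕ.^ suc (length J) ℕ.* unit
        e≤ = ℕ.≤-trans
          (enum-steps C′ q′ I′ Y′ (rec (generateI-< C q′ I (J⊆I (here refl)))) (generateI-Increasing C′ q′ I-inc)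
            (ℕ.≤-trans (ℕ.+-mono-≤ I′≤J (generateX-≤ C′ q′ Y)) (ℕ.≤-trans (ℕ.n≤1+n _) J+Y≤n)))
          (ℕ.*-monoˡ-≤ unit (ℕ.^-monoʳ-≤ 2 (s≤s I′≤J)))

        rest≤ : steps rest ℕ.+ (unit ℕ.+ unit) ℕ.≤ 2 ℕ.^ suc (length J) ℕ.* unit
        rest≤ = loop-steps C q I X rec (P ++ (u , r) ∷ []) J (J⊆I ∘ there) ((u , r) ∷ Y)
          (trans I≡ (sym (List.++-assoc P _ J))) I-inc J-inc
          (All.++⁺ (All.map All.tail P<J) (u<J ∷ [])) I≤n J+1+Y≤n

        eq : ∀ d e s → d ℕ.+ (e ℕ.+ s) ℕ.+ (d ℕ.+ d) ≡ (e ℕ.+ d) ℕ.+ (s ℕ.+ (d ℕ.+ d))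
        eq = solve-∀

        double : ∀ x d → 2 ℕ.* x ℕ.* d ≡ x ℕ.* d ℕ.+ x ℕ.* d
        double = solve-∀

    run-steps : steps run ℕ.≤ 2 ℕ.^ suc n ℕ.* unit
    run-steps = begin
      κ ℕ.* n ℕ.+ e                       ≡⟨ ℕ.+-comm (κ ℕ.* n) e ⟩
      e ℕ.+ κ ℕ.* n
        -- The construction of `Î` is paid for by the spare `unit` in `enum-steps`.
        ≤⟨ ℕ.+-monoʳ-≤ e (ℕ.*-monoʳ-≤ κ (ℕ.≤-trans (ℕ.m≤m+n n _) (ℕ.m≤m+n _ 3))) ⟩
      e ℕ.+ unit                          ≤⟨ enum-steps ∅ 1# Î [] a Î-inc
                                               (ℕ.≤-reflexive (trans (ℕ.+-identityʳ _) Î-length)) ⟩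
      2 ℕ.^ suc (length Î) ℕ.* unit       ≡⟨ cong (λ l → 2 ℕ.^ suc l ℕ.* unit) Î-length ⟩
      2 ℕ.^ suc n ℕ.* unit                ∎
      where
      open ℕ.≤-Reasoning
      Î = map (_, 1#) (allFin n)
      a = ℕ.<-wellFounded (length Î)
      e = steps (enum ∅ 1# Î [] a)
      Î-length : length Î ≡ n
      Î-length = trans (List.length-map (_, 1#) (allFin n)) (List.length-tabulate {n = n} id)
      Î-inc : Increasing Î
      Î-inc = AllPairs.map⁺ (AllPairs.tabulate⁺-< id)

  -- 48 = 2 * (21 + 3): the 2 comes from 2 ^ suc n, and 1 ≤ n turns the summand 3 of `unit` into 3 *
  -- n.
  mule-steps : ∀ κ {n} α (𝒢 : UncertainGraph n) → 1 ℕ.≤ n → muleTime κ α 𝒢 ℕ.≤ 48 ℕ.* κ ℕ.* n ℕ.* 2 ℕ.^ n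
  mule-steps κ {n} α 𝒢 1≤n = begin
    muleTime κ α 𝒢                               ≤⟨ RunningTime.run-steps κ α (prune α 𝒢) ⟩
    2 ℕ.^ suc n ℕ.* (κ ℕ.* (21 ℕ.* n ℕ.+ 3))
      ≤⟨ ℕ.*-monoʳ-≤ (2 ℕ.^ suc n) (ℕ.*-monoʳ-≤ κ (ℕ.+-monoʳ-≤ (21 ℕ.* n) (ℕ.*-monoʳ-≤ 3 1≤n))) ⟩
    2 ℕ.^ suc n ℕ.* (κ ℕ.* (21 ℕ.* n ℕ.+ 3 ℕ.* n)) ≡⟨ eq κ n (2 ℕ.^ n) ⟩
    48 ℕ.* κ ℕ.* n ℕ.* 2 ℕ.^ n                    ∎
    where
    open ℕ.≤-Reasoning
    eq : ∀ κ n x → 2 ℕ.* x ℕ.* (κ ℕ.* (21 ℕ.* n ℕ.+ 3 ℕ.* n)) ≡ 48 ℕ.* κ ℕ.* n ℕ.* x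
    eq = solve-∀

-- The lower bound and the comparison

module _ {c ℓ₁ ℓ₂} (ℝ : Reals c ℓ₁ ℓ₂) where
  open Reals ℝ using (0#; 1#; _<_; ≤-respʳ-≈) renaming (_≤_ to _≤ᵣ_; sym to ≈-sym)
  open OrderedField ℝ using (separating-power) renaming (_^_ to _^ᵣ_)
  open UncertainGraphs ℝ
  open EnumerationAlgorithm

  output-lower-bound : ∀ {α} → 0# < α → α < 1# → (A : EnumerationAlgorithm α) (n k : ℕ) → 2 ℕ.≤ k →
                       ∃[ 𝒢 ] (n ℕ.C k) ℕ.* k ℕ.≤ time A {n} 𝒢
  output-lower-bound {α} 0<α α<1 A n k@(suc k-1@(suc _)) (s≤s (s≤s _)) =
    -- For k ≥ 2 there is an edge inside a set of k vertices, so the smaller exponent is positive,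
    -- and one more vertex adds k further edges.
    lower-bound (separating-power 0<α α<1 {binom₂ k} {binom₂ (suc k)} (s≤s z≤n) (s≤s (ℕ.m≤n+m (binom₂ k) k-1)))
    where
    lower-bound : ∃[ p ] 0# < p × p ≤ᵣ 1# × α ≤ᵣ p ^ᵣ binom₂ k × ¬ (α ≤ᵣ p ^ᵣ binom₂ (suc k)) →
                  ∃[ 𝒢 ] (n ℕ.C k) ℕ.* k ℕ.≤ time A {n} 𝒢
    lower-bound (p , 0<p , p≤1 , α≤ , α≰) = completeGraph , (begin
      (n ℕ.C k) ℕ.* k                          ≡⟨ cong (ℕ._* k) (length-ofSize n k) ⟨
      length (ofSize n k) ℕ.* k

        ≤⟨ length-*-≤-sum ∣_∣ (output A completeGraph) (ofSize-unique n k) (ofSize-∣∣ n k)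
             (All.map (λ {M} ∣M∣≡k → Equivalence.from (enumerates A completeGraph M) (maximal M ∣M∣≡k))
               (ofSize-∣∣ n k)) ⟩
      sum (map ∣_∣ (output A completeGraph))   ≤⟨ output≤time A completeGraph ⟩
      time A completeGraph                     ∎)
      where
      open ℕ.≤-Reasoning
      open Complete ℝ n p 0<p p≤1
      maximal : ∀ M → ∣ M ∣ ≡ k → IsαMaximalClique α completeGraph M
      maximal M ∣M∣≡k =
        ≤-respʳ-≈ (≈-sym (clq≈ M)) (subst (λ l → α ≤ᵣ p ^ᵣ binom₂ l) (sym ∣M∣≡k) α≤) ,
        λ (v , v∉M , α≤clq) → α≰ (subst (λ l → α ≤ᵣ p ^ᵣ binom₂ l)
          (trans (∣p∪⁅x⁆∣≡1+∣p∣ M v∉M) (cong suc ∣M∣≡k)) (≤-respʳ-≈ (clq≈ (M ∪ ⁅ v ⁆)) α≤clq))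

lemma12 : ∀ {c ℓ₁ ℓ₂} (ℝ : Reals c ℓ₁ ℓ₂) →
    let open Reals ℝ
        open UncertainGraphs ℝ
        open EnumerationAlgorithm using (time)
    in (α : Carrier) → 0# < α → α < 1# → (κ : ℕ) →
       ∃[ K ] ∃[ n₀ ] ((A : EnumerationAlgorithm α) (n : ℕ) → n₀ ℕ.≤ n →
         ∀ t → WorstCase≤ {n} (time A) t → WorstCase≤√ {n} (muleTime κ α) K t)
-- 288 = 48 * 6, where 6 ^ 2 ≥ 4 * 8 absorbs the constants of n ^ 2 ≤ 4 * k ^ 2 and
-- 4 ^ n ≤ 8 * n * (n C k) ^ 2.
lemma12 ℝ α 0<α α<1 κ = 288 ℕ.* κ , 3 , λ A n 3≤n t time≤t 𝒢 →
  let k , n≤2k , 4^n≤ = 4^n≤8n*nCk² n (ℕ.≤-trans (s≤s z≤n) 3≤n)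
      -- The threshold 3 is chosen so that 3 ≤ n ≤ 2 * k forces k ≥ 2.
      𝒢′ , nCk*k≤time = output-lower-bound ℝ 0<α α<1 A n k (ℕ.*-cancelˡ-< 2 1 k (ℕ.≤-trans 3≤n n≤2k))
  in arithmetic n k (mule-steps ℝ κ α 𝒢 (ℕ.≤-trans (s≤s z≤n) 3≤n)) n≤2k 4^n≤ (ℕ.≤-trans nCk*k≤time (time≤t 𝒢′))
  where
  arithmetic : ∀ n k {s t} → s ℕ.≤ 48 ℕ.* κ ℕ.* n ℕ.* 2 ℕ.^ n → n ℕ.≤ 2 ℕ.* k →
               4 ℕ.^ n ℕ.≤ 8 ℕ.* n ℕ.* (n ℕ.C k) ℕ.^ 2 → (n ℕ.C k) ℕ.* k ℕ.≤ t →
               s ℕ.^ 2 ℕ.≤ (288 ℕ.* κ) ℕ.^ 2 ℕ.* n ℕ.* t ℕ.^ 2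
  arithmetic n k {s} {t} s≤ n≤2k 4^n≤ b*k≤t = begin
    s ℕ.^ 2                                              ≤⟨ ℕ.^-monoˡ-≤ 2 s≤ ⟩
    (48 ℕ.* κ ℕ.* n ℕ.* 2 ℕ.^ n) ℕ.^ 2                   ≡⟨ square κ n (2 ℕ.^ n) ⟩
    (48 ℕ.* κ) ℕ.^ 2 ℕ.* (n ℕ.^ 2 ℕ.* (2 ℕ.^ n ℕ.* 2 ℕ.^ n))
      ≡⟨ cong (λ x → (48 ℕ.* κ) ℕ.^ 2 ℕ.* (n ℕ.^ 2 ℕ.* x)) 2^n*2^n≡4^n ⟩
    (48 ℕ.* κ) ℕ.^ 2 ℕ.* (n ℕ.^ 2 ℕ.* 4 ℕ.^ n)
      ≤⟨ ℕ.*-monoʳ-≤ ((48 ℕ.* κ) ℕ.^ 2) (ℕ.*-mono-≤ (ℕ.^-monoˡ-≤ 2 n≤2k) 4^n≤) ⟩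
    (48 ℕ.* κ) ℕ.^ 2 ℕ.* ((2 ℕ.* k) ℕ.^ 2 ℕ.* (8 ℕ.* n ℕ.* b ℕ.^ 2))
      ≤⟨ ℕ.m≤m+n _ (4 ℕ.* ((48 ℕ.* κ) ℕ.^ 2 ℕ.* n ℕ.* (b ℕ.* k) ℕ.^ 2)) ⟩
    (48 ℕ.* κ) ℕ.^ 2 ℕ.* ((2 ℕ.* k) ℕ.^ 2 ℕ.* (8 ℕ.* n ℕ.* b ℕ.^ 2)) ℕ.+
      4 ℕ.* ((48 ℕ.* κ) ℕ.^ 2 ℕ.* n ℕ.* (b ℕ.* k) ℕ.^ 2)
      ≡⟨ regroup κ n k b ⟩
    (288 ℕ.* κ) ℕ.^ 2 ℕ.* n ℕ.* (b ℕ.* k) ℕ.^ 2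
      ≤⟨ ℕ.*-monoʳ-≤ ((288 ℕ.* κ) ℕ.^ 2 ℕ.* n) (ℕ.^-monoˡ-≤ 2 b*k≤t) ⟩
    (288 ℕ.* κ) ℕ.^ 2 ℕ.* n ℕ.* t ℕ.^ 2                  ∎
    where
    open ℕ.≤-Reasoning
    b = n ℕ.C k
    2^n*2^n≡4^n : 2 ℕ.^ n ℕ.* 2 ℕ.^ n ≡ 4 ℕ.^ n
    2^n*2^n≡4^n = trans (sym (ℕ.^-distribˡ-+-* 2 n n))
      (trans (cong (λ m → 2 ℕ.^ (n ℕ.+ m)) (sym (ℕ.+-identityʳ n))) (sym (ℕ.^-*-assoc 2 2 n)))
    square : ∀ κ n x → 48 ℕ.* κ ℕ.* n ℕ.* x ℕ.* (48 ℕ.* κ ℕ.* n ℕ.* x ℕ.* 1) ≡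
             48 ℕ.* κ ℕ.* (48 ℕ.* κ ℕ.* 1) ℕ.* (n ℕ.* (n ℕ.* 1) ℕ.* (x ℕ.* x))
    square = solve-∀
    regroup : ∀ κ n k b →
      48 ℕ.* κ ℕ.* (48 ℕ.* κ ℕ.* 1) ℕ.* (2 ℕ.* k ℕ.* (2 ℕ.* k ℕ.* 1) ℕ.* (8 ℕ.* n ℕ.* (b ℕ.* (b ℕ.* 1)))) ℕ.+
        4 ℕ.* (48 ℕ.* κ ℕ.* (48 ℕ.* κ ℕ.* 1) ℕ.* n ℕ.* (b ℕ.* k ℕ.* (b ℕ.* k ℕ.* 1))) ≡
      288 ℕ.* κ ℕ.* (288 ℕ.* κ ℕ.* 1) ℕ.* n ℕ.* (b ℕ.* k ℕ.* (b ℕ.* k ℕ.* 1))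
    regroup = solve-∀
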